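{- Let $c$ be an even positive integer and $n\ge 1$. Then $$\sum_{\pi \in G_{c,n}} (-1)^{L(\pi)} q^{fmaj(\pi)}=[c]_{ -q}\,[2c]_q\,[3c]_{ -q}\,[4c]_{q}\cdots [nc]_{(-1)^{n}q}=\prod_{i=1}^{n}[ci]_{(-1)^i q}.$$
   Context: For positive integers $c,n$, the group $G_{c,n}$ of colored permutations consists of all words $\pi=\pi_1^{[t_1]}\pi_2^{[t_2]}\cdots\pi_n^{[t_n]}$ where $\pi_1\pi_2\cdots\pi_n$ is a permutation of $[n]=\{1,\dots,n\}$ (called $|\pi|$) and each color $t_i\in\{0,1,\dots,c-1\}$. The color number is $col(\pi)=\sum_i t_i$. For a permutation $\sigma$, $inv(\sigma)=|\{(i,j): i<j,\ \sigma_i>\sigma_j\}|$. The length of $\pi$ is $$L(\pi)=col(\pi)+c\cdot\sum_{j:\,t_j\neq 0}|\{i: i<j,\ \pi_i<\pi_j\}|+inv(|\pi|).$$ Order the colored letters by the total order $1^{[c-1]}<\cdots<n^{[c-1]}<\cdots<1^{[2]}<\cdots<n^{[2]}<1^{[1]}<\cdots<n^{[1]}<1<\cdots<n$ (letters of color $0$ written without superscript). Let $Des_c(\pi)=\{i\in[n-1]: \pi_i^{[t_i]}>\pi_{i+1}^{[t_{i+1}]}\}$ in this order, $maj(\pi)=\sum_{i\in Des_c(\pi)} i$, and the flag major index $fmaj(\pi)=c\cdot maj(\pi)+col(\pi)$. For a positive integer $m$ and indeterminate $x$, $[m]_x=\frac{1-x^m}{1-x}=1+x+\cdots+x^{m-1}$.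 -}

module Defs where

open import Level using (Level)
open import Data.Nat using (ℕ; zero; suc; _∸_; _<ᵇ_; _≡ᵇ_)
open import Data.Nat as N using ()
open import Data.Bool using (Bool; true; false; if_then_else_; _∧_; _∨_; not)
open import Data.List using (List; []; _∷_; map; concatMap; foldr; length; upTo)
open import Data.Nat.ListAction using (sum)
open import Data.Product using (_×_; _,_; proj₁; proj₂)
open import Algebra.Bundles using (CommutativeRing)

-- Colored permutations.
-- A colored word is a list of pairs (letter , color); the word
-- π₁^[t₁] ⋯ πₙ^[tₙ] is the list (π₁ , t₁) ∷ ⋯ ∷ (πₙ , tₙ) ∷ [].

Word : Set
Word = List (ℕ × ℕ)

insertions : ℕ → List ℕ → List (List ℕ)
insertions x []       = (x ∷ []) ∷ []
insertions x (y ∷ ys) = (x ∷ y ∷ ys) ∷ map (y ∷_) (insertions x ys)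

perms : ℕ → List (List ℕ)
perms zero    = [] ∷ []
perms (suc n) = concatMap (insertions (suc n)) (perms n)

colorings : ℕ → ℕ → List (List ℕ)
colorings c zero    = [] ∷ []
colorings c (suc n) = concatMap (λ ts → map (_∷ ts) (upTo c)) (colorings c n)

zipW : List ℕ → List ℕ → Word
zipW (a ∷ as) (t ∷ ts) = (a , t) ∷ zipW as ts
zipW _        _        = []

G : ℕ → ℕ → List Word
G c n = concatMap (λ σ → map (zipW σ) (colorings c n)) (perms n)

count : {A : Set} → (A → Bool) → List A → ℕ
count p []       = 0
count p (x ∷ xs) = (if p x then 1 else 0) N.+ count p xs

col : Word → ℕ
col w = sum (map proj₂ w)

inv : Word → ℕ
inv []             = 0
inv ((a , _) ∷ w)  = count (λ p → proj₁ p <ᵇ a) w N.+ inv w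

nzAsc : Word → Word → ℕ
nzAsc before []             = 0
nzAsc before ((b , s) ∷ w)  =
  (if s ≡ᵇ 0 then 0 else count (λ p → proj₁ p <ᵇ b) before)
  N.+ nzAsc ((b , s) ∷ before) w

L : ℕ → Word → ℕ
L c w = col w N.+ c N.* nzAsc [] w N.+ inv w

-- Total order on colored letters:
-- 1^[c-1] < … < n^[c-1] < … < 1^[1] < … < n^[1] < 1 < … < n.
-- colorRank 0 = c and colorRank t = c ∸ t for 1 ≤ t ≤ c-1, so that the
-- colors are ranked c-1 ↦ 1, …, 1 ↦ c-1, 0 ↦ c; letters are compared
-- first by colorRank, then by value.
colorRank : ℕ → ℕ → ℕ
colorRank c zero    = c
colorRank c (suc t) = c ∸ suc t

gtC : ℕ → ℕ × ℕ → ℕ × ℕ → Bool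
gtC c (a , t) (b , s) =
  (colorRank c s <ᵇ colorRank c t) ∨ ((colorRank c s ≡ᵇ colorRank c t) ∧ (b <ᵇ a))

-- maj(π) = Σ_{i ∈ Des_c(π)} i, positions counted from 1; `i` is the position of the head
majFrom : ℕ → ℕ → Word → ℕ
majFrom c i []            = 0
majFrom c i (x ∷ [])      = 0
majFrom c i (x ∷ y ∷ w)   = (if gtC c x y then i else 0) N.+ majFrom c (suc i) (y ∷ w)

maj : ℕ → Word → ℕ
maj c w = majFrom c 1 w

fmaj : ℕ → Word → ℕ
fmaj c w = c N.* maj c w N.+ col w

-- Ring-valued expressions (the polynomial identity is stated in every
-- commutative ring R for every q ∈ R, i.e. as an identity in ℤ[q]).

module RingExpr {a ℓ : Level} (R : CommutativeRing a ℓ) where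
  open CommutativeRing R

  pow : Carrier → ℕ → Carrier
  pow x zero    = 1#
  pow x (suc k) = x * pow x k

  qint : ℕ → Carrier → Carrier
  qint zero    x = 0#
  qint (suc m) x = 1# + x * qint m x

  sumR : List Carrier → Carrier
  sumR = foldr _+_ 0#

  lhs : ℕ → ℕ → Carrier → Carrier
  lhs c n q = sumR (map (λ w → pow (- 1#) (L c w) * pow q (fmaj c w)) (G c n))

  prodFrom : ℕ → ℕ → ℕ → Carrier → Carrier
  prodFrom c i zero    q = 1#
  prodFrom c i (suc k) q = qint (c N.* i) (pow (- 1#) i * q) * prodFrom c (suc i) k q

  rhs : ℕ → ℕ → Carrier → Carrier
  rhs c n q = prodFrom c 1 n q

{-# OPTIONS --safe #-}

-- Since c is even, (-1)^L = (-1)^(col + inv). Put Q = q^c and build G_{c,n+2} from G_{c,n} by inserting the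
-- two largest letters n+1 and n+2. Exchanging these two letters while keeping the colors in place changes the
-- parity of inv but neither col nor, unless they are adjacent and equally colored, the descent set. So only the
-- words survive in which they form a block of a single color t. For such a block inserted into a fixed word w,
-- the two orders differ by the sign and by a descent inside the block, and summing over all gaps telescopes to
-- q^(2t) (1 - Q^(n+1))(1 - Q^(n+2)) / (1 - Q²) times the weight of w, whatever w and t are. Summing over t gives
-- the two new factors [c(n+1)] [c(n+2)] of the product. The induction starts from n = 0 and n = 1.
module Submission where

open import Defs
open import Level using (Level)
open import Algebra.Bundles using (CommutativeRing)
import Algebra.Properties.CommutativeSemigroup
import Algebra.Properties.Ring
import Algebra.Solver.Ring.NaturalCoefficients.Default
open import Data.Bool using (Bool; true; false; not; if_then_else_)
open import Data.Bool.Properties using (T-≡; ¬-not)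
open import Data.List using (List; []; _∷_; _++_; map; length; concatMap; upTo; applyUpTo)
open import Data.List.Properties using (length-++; map-upTo)
open import Data.List.Relation.Unary.All as All using (All; []; _∷_)
open import Data.List.Relation.Unary.All.Properties using (++⁺; ++⁻; concat⁺; map⁺; all-upTo)
open import Data.List.Relation.Unary.AllPairs using (AllPairs; []; _∷_)
import Data.List.Relation.Unary.AllPairs.Properties as AllPairs
open import Data.Nat as ℕ using (ℕ; zero; suc; _≤_; _<_; s≤s; _<ᵇ_; _≡ᵇ_; _∸_)
open import Data.Nat.Divisibility using (_∣_; divides; ∣m⇒∣m*n)
open import Data.Nat.Properties as ℕₚ using (≤-refl; n≤1+n; ≤-trans)
open import Data.Nat.Solver using (module +-*-Solver)
open import Data.Product using (_×_; _,_; proj₁; proj₂)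
open import Data.Sum using (_⊎_; inj₁; inj₂)
open import Function using (_∘_; Equivalence)
open import Relation.Binary.Definitions using (tri<; tri≈; tri>)
open import Relation.Binary.PropositionalEquality as ≡ using (_≡_)
open import Relation.Nullary using (¬_; yes; no; contradiction)

-- Inversions and color sums under insertion of large letters.

module Words where
  open ≡
  open ℕₚ
  open Algebra.Properties.CommutativeSemigroup +-commutativeSemigroup using (x∙yz≈y∙xz)

  Small : ℕ → Word → Set
  Small n = All (λ p → proj₁ p ≤ n)

  <ᵇ-true : ∀ {m n} → m < n → (m <ᵇ n) ≡ true
  <ᵇ-true m<n = Equivalence.to T-≡ (<⇒<ᵇ m<n)

  <ᵇ-false : ∀ {m n} → n ≤ m → (m <ᵇ n) ≡ false
  <ᵇ-false {m} n≤m = ¬-not λ eq → ≤⇒≯ n≤m (<ᵇ⇒< m _ (Equivalence.from T-≡ eq))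

  ≡ᵇ-refl : ∀ n → (n ≡ᵇ n) ≡ true
  ≡ᵇ-refl n = Equivalence.to T-≡ (≡⇒≡ᵇ n n refl)

  ≡ᵇ-false : ∀ {m n} → ¬ (m ≡ n) → (m ≡ᵇ n) ≡ false
  ≡ᵇ-false {m} m≢n = ¬-not λ eq → m≢n (≡ᵇ⇒≡ m _ (Equivalence.from T-≡ eq))

  count-++ : {A : Set} (p : A → Bool) (u v : List A) → count p (u ++ v) ≡ count p u ℕ.+ count p v
  count-++ p []      v = refl
  count-++ p (x ∷ u) v = trans (cong ((if p x then 1 else 0) ℕ.+_) (count-++ p u v))
    (sym (ℕₚ.+-assoc (if p x then 1 else 0) (count p u) (count p v)))

  count-below : ∀ {n b w} → n < b → Small n w → count (λ p → proj₁ p <ᵇ b) w ≡ length w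
  count-below n<b []         = refl
  count-below n<b (x≤n ∷ sw) rewrite <ᵇ-true (≤-<-trans x≤n n<b) = cong suc (count-below n<b sw)

  count-insert : ∀ {a x} t u v → a ≤ x →
    count (λ p → proj₁ p <ᵇ a) (u ++ (x , t) ∷ v) ≡ count (λ p → proj₁ p <ᵇ a) (u ++ v)
  count-insert {a} {x} t u v a≤x = begin
    count p (u ++ (x , t) ∷ v)        ≡⟨ count-++ p u _ ⟩
    count p u ℕ.+ count p ((x , t) ∷ v) ≡⟨ cong (λ b → count p u ℕ.+ ((if b then 1 else 0) ℕ.+ count p v)) (<ᵇ-false a≤x) ⟩
    count p u ℕ.+ count p v           ≡⟨ count-++ p u v ⟨
    count p (u ++ v)                  ∎
    where
    open ≡-Reasoning
    p : ℕ × ℕ → Bool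
    p y = proj₁ y <ᵇ a

  -- A letter larger than all others is inverted with exactly the letters to its right.
  inv-insert : ∀ {n x} t {u v} → n < x → Small n u → Small n v →
    inv (u ++ (x , t) ∷ v) ≡ length v ℕ.+ inv (u ++ v)
  inv-insert t n<x [] sv = cong (ℕ._+ _) (count-below n<x sv)
  inv-insert {x = x} t {(a , r) ∷ u} {v} n<x (a≤n ∷ su) sv = begin
    below (u ++ (x , t) ∷ v) ℕ.+ inv (u ++ (x , t) ∷ v)
      ≡⟨ cong₂ ℕ._+_ (count-insert t u v (≤-trans a≤n (<⇒≤ n<x))) (inv-insert t n<x su sv) ⟩
    below (u ++ v) ℕ.+ (length v ℕ.+ inv (u ++ v))
      ≡⟨ x∙yz≈y∙xz (below (u ++ v)) (length v) _ ⟩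
    length v ℕ.+ (below (u ++ v) ℕ.+ inv (u ++ v)) ∎
    where
    open ≡-Reasoning
    below : Word → ℕ
    below = count (λ p → proj₁ p <ᵇ a)

  -- Both large letters exceed every letter of u, v and z, so their inversions with these depend on
  -- positions only. Only the pair they form with each other changes.
  inv-swap : ∀ {n} t s {u v z} → Small n u → Small n v → Small n z →
    inv (u ++ (2 ℕ.+ n , t) ∷ v ++ (suc n , s) ∷ z) ≡ suc (inv (u ++ (suc n , t) ∷ v ++ (2 ℕ.+ n , s) ∷ z))
  inv-swap {n} t s {[]} {v} {z} [] sv sz = cong₂ ℕ._+_ counts
    (trans (inv-insert s ≤-refl sv sz) (sym (inv-insert s (m<n⇒m<1+n ≤-refl) sv sz)))
    where
    open ≡-Reasoning
    below : ℕ → Word → ℕ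
    below b = count (λ p → proj₁ p <ᵇ b)
    small⇒< : ∀ {b w} → n < b → Small n w → Small (ℕ.pred b) w
    small⇒< (s≤s n≤b) = All.map (λ x≤n → ≤-trans x≤n n≤b)
    -- The extra inversion arises here: the larger letter in front has `suc n` below it, while
    -- `suc n` in front does not count `2 ℕ.+ n`.
    counts : below (2 ℕ.+ n) (v ++ (suc n , s) ∷ z) ≡ suc (below (suc n) (v ++ (2 ℕ.+ n , s) ∷ z))
    counts = begin
      below (2 ℕ.+ n) (v ++ (suc n , s) ∷ z)
        ≡⟨ count-below ≤-refl (++⁺ (small⇒< (m<n⇒m<1+n ≤-refl) sv) (≤-refl ∷ small⇒< (m<n⇒m<1+n ≤-refl) sz)) ⟩
      length (v ++ (suc n , s) ∷ z)      ≡⟨ length-++ v ⟩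
      length v ℕ.+ suc (length z)        ≡⟨ ℕₚ.+-suc (length v) (length z) ⟩
      suc (length v ℕ.+ length z)        ≡⟨ cong suc (length-++ v) ⟨
      suc (length (v ++ z))              ≡⟨ cong suc (count-below ≤-refl (++⁺ sv sz)) ⟨
      suc (below (suc n) (v ++ z))       ≡⟨ cong suc (count-insert s v z (n≤1+n _)) ⟨
      suc (below (suc n) (v ++ (2 ℕ.+ n , s) ∷ z)) ∎
  inv-swap {n} t s {(a , r) ∷ u} {v} {z} (a≤n ∷ su) sv sz = begin
    below (u ++ (2 ℕ.+ n , t) ∷ v ++ (suc n , s) ∷ z) ℕ.+ inv (u ++ (2 ℕ.+ n , t) ∷ v ++ (suc n , s) ∷ z)
      ≡⟨ cong₂ ℕ._+_ (trans (insert₂ (≤-trans a≤1+n (n≤1+n _)) a≤1+n) (sym (insert₂ a≤1+n (≤-trans a≤1+n (n≤1+n _)))))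
                     (inv-swap t s su sv sz) ⟩
    below (u ++ (suc n , t) ∷ v ++ (2 ℕ.+ n , s) ∷ z) ℕ.+ suc (inv (u ++ (suc n , t) ∷ v ++ (2 ℕ.+ n , s) ∷ z))
      ≡⟨ ℕₚ.+-suc _ _ ⟩
    suc (below (u ++ (suc n , t) ∷ v ++ (2 ℕ.+ n , s) ∷ z) ℕ.+ inv (u ++ (suc n , t) ∷ v ++ (2 ℕ.+ n , s) ∷ z)) ∎
    where
    open ≡-Reasoning
    below : Word → ℕ
    below = count (λ p → proj₁ p <ᵇ a)
    a≤1+n : a ≤ suc n
    a≤1+n = ≤-trans a≤n (n≤1+n n)
    insert₂ : ∀ {x y} → a ≤ x → a ≤ y → below (u ++ (x , t) ∷ v ++ (y , s) ∷ z) ≡ below u ℕ.+ below (v ++ z)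
    insert₂ a≤x a≤y = trans (count-insert t u _ a≤x)
      (trans (count-++ _ u _) (cong (below u ℕ.+_) (count-insert s v z a≤y)))

  -- Each of the two block letters is inverted with all of v, and in increasing order they are not
  -- inverted with each other. The contribution is even, so it does not affect the sign.
  inv-block : ∀ {n} t {u v} → Small n u → Small n v →
    inv (u ++ (suc n , t) ∷ (2 ℕ.+ n , t) ∷ v) ≡ (length v ℕ.+ length v) ℕ.+ inv (u ++ v)
  inv-block {n} t {[]} {v} [] sv = begin
    count p ((2 ℕ.+ n , t) ∷ v) ℕ.+ inv ((2 ℕ.+ n , t) ∷ v)
      ≡⟨ cong₂ ℕ._+_ (trans (count-insert {suc n} t [] v (n≤1+n _)) (count-below ≤-refl sv)) (inv-insert t {[]} (m<n⇒m<1+n ≤-refl) [] sv) ⟩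
    length v ℕ.+ (length v ℕ.+ inv v) ≡⟨ ℕₚ.+-assoc (length v) _ _ ⟨
    (length v ℕ.+ length v) ℕ.+ inv v ∎
    where
    open ≡-Reasoning
    p : ℕ × ℕ → Bool
    p y = proj₁ y <ᵇ suc n
  inv-block {n} t {(a , r) ∷ u} {v} (a≤n ∷ su) sv = begin
    below (u ++ (suc n , t) ∷ (2 ℕ.+ n , t) ∷ v) ℕ.+ inv (u ++ (suc n , t) ∷ (2 ℕ.+ n , t) ∷ v)
      ≡⟨ cong₂ ℕ._+_ (trans (count-insert t u _ (m≤n⇒m≤1+n a≤n)) (count-insert t u v (m≤n⇒m≤1+n (m≤n⇒m≤1+n a≤n)))) (inv-block t su sv) ⟩
    below (u ++ v) ℕ.+ ((length v ℕ.+ length v) ℕ.+ inv (u ++ v))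
      ≡⟨ x∙yz≈y∙xz (below (u ++ v)) (length v ℕ.+ length v) _ ⟩
    (length v ℕ.+ length v) ℕ.+ (below (u ++ v) ℕ.+ inv (u ++ v)) ∎
    where
    open ≡-Reasoning
    below : Word → ℕ
    below = count (λ p → proj₁ p <ᵇ a)

  col-insert : ∀ x t u v → col (u ++ (x , t) ∷ v) ≡ t ℕ.+ col (u ++ v)
  col-insert x t []            v = refl
  col-insert x t ((_ , r) ∷ u) v = trans (cong (r ℕ.+_) (col-insert x t u v)) (x∙yz≈y∙xz r t _)

  col-swap : ∀ x y t s u v z → col (u ++ (x , t) ∷ v ++ (y , s) ∷ z) ≡ col (u ++ (y , t) ∷ v ++ (x , s) ∷ z)
  col-swap x y t s (_ ∷ u) v z = cong (_ ℕ.+_) (col-swap x y t s u v z)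
  col-swap x y t s []      v z = cong (t ℕ.+_) (trans (col-insert y s v z) (sym (col-insert x s v z)))

  col-block : ∀ x y t u v → col (u ++ (x , t) ∷ (y , t) ∷ v) ≡ (t ℕ.+ t) ℕ.+ col (u ++ v)
  col-block x y t u v = trans (col-insert x t u _)
    (trans (cong (t ℕ.+_) (col-insert y t u v)) (sym (ℕₚ.+-assoc t t _)))

  -- Both clauses of `colorRank` compute c ∸ s, and truncated subtraction from c is injective on
  -- numbers at most c.
  colorRank-injective : ∀ {c s t} → s < c → t < c → colorRank c s ≡ colorRank c t → s ≡ t
  colorRank-injective {c} {s} {t} s<c t<c eq = ∸-cancelˡ-≡ (<⇒≤ s<c) (<⇒≤ t<c) (trans (sym (rank s)) (trans eq (rank t)))
    where
    rank : ∀ s → colorRank c s ≡ c ∸ s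
    rank zero    = refl
    rank (suc s) = refl

  -- The order on colored letters and the descent set.

  module Order (c : ℕ) where

    -- Since b < x settles every tie, the outcome depends on the two colors alone. This is what
    -- makes the two large letters interchangeable next to a small one.
    large>small : ∀ {x b} t s → b < x → gtC c (x , t) (b , s) ≡ not (colorRank c t <ᵇ colorRank c s)
    large>small {x} {b} t s b<x with <-cmp (colorRank c t) (colorRank c s)
    ... | tri< t<s t≢s _ rewrite <ᵇ-true t<s | <ᵇ-false (<⇒≤ t<s) | ≡ᵇ-false (t≢s ∘ sym) = refl
    ... | tri≈ _ t≡s _ rewrite t≡s | <ᵇ-false (≤-refl {colorRank c s}) | ≡ᵇ-refl (colorRank c s) | <ᵇ-true b<x = refl
    ... | tri> _ _ s<t rewrite <ᵇ-true s<t | <ᵇ-false (<⇒≤ s<t) = refl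

    small>large : ∀ {x b} t s → b < x → gtC c (b , s) (x , t) ≡ (colorRank c t <ᵇ colorRank c s)
    small>large {x} {b} t s b<x with <-cmp (colorRank c t) (colorRank c s)
    ... | tri< t<s _ _ rewrite <ᵇ-true t<s = refl
    ... | tri≈ _ t≡s _ rewrite t≡s | <ᵇ-false (≤-refl {colorRank c s}) | ≡ᵇ-refl (colorRank c s) | <ᵇ-false (<⇒≤ b<x) = refl
    ... | tri> _ t≢s s<t rewrite <ᵇ-false (<⇒≤ s<t) | ≡ᵇ-false t≢s = refl

    small>large-flip : ∀ {x b} t s → b < x → gtC c (b , s) (x , t) ≡ not (gtC c (x , t) (b , s))
    small>large-flip t s b<x rewrite large>small t s b<x | small>large t s b<x with colorRank c t <ᵇ colorRank c s
    ... | true  = refl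
    ... | false = refl

    -- Distinct colors below c have distinct ranks, so the tie-breaking comparison of letters never
    -- comes into play.
    gtC-relabel : ∀ x x' y y' {t s} → s < c → t < c → ¬ (t ≡ s) → gtC c (x , t) (y , s) ≡ gtC c (x' , t) (y' , s)
    gtC-relabel x x' y y' {t} {s} s<c t<c t≢s
      rewrite ≡ᵇ-false {colorRank c s} {colorRank c t} (t≢s ∘ sym ∘ colorRank-injective s<c t<c) = refl

    gtC-same-color : ∀ x y t → gtC c (x , t) (y , t) ≡ (y <ᵇ x)
    gtC-same-color x y t rewrite <ᵇ-false (≤-refl {colorRank c t}) | ≡ᵇ-refl (colorRank c t) = refl

    -- The comparisons (x > a, x > b, a > b) that a total order allows.
    data Compatible : Bool → Bool → Bool → Set where
      both   : ∀ {g} → Compatible true true g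
      none   : ∀ {g} → Compatible false false g
      b<x<a : Compatible false true true
      a<x<b : Compatible true false false

    -- The rank of a small letter decides on which side of x it lies. If x separates a from b, their
    -- ranks are strictly ordered, which forces the third comparison.
    compatible : ∀ {x} t {a b} r s → a < x → b < x →
      Compatible (gtC c (x , t) (a , r)) (gtC c (x , t) (b , s)) (gtC c (a , r) (b , s))
    compatible t r s a<x b<x rewrite large>small t r a<x | large>small t s b<x
      with colorRank c t ℕ.<? colorRank c r | colorRank c t ℕ.<? colorRank c s
    ... | yes t<r | yes t<s rewrite <ᵇ-true t<r | <ᵇ-true t<s = none
    ... | yes t<r | no  t≮s rewrite <ᵇ-true t<r | <ᵇ-false (≮⇒≥ t≮s) | <ᵇ-true (≤-<-trans (≮⇒≥ t≮s) t<r) = b<x<a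
    ... | no  t≮r | yes t<s rewrite <ᵇ-false (≮⇒≥ t≮r) | <ᵇ-true t<s
          | <ᵇ-false (<⇒≤ (≤-<-trans (≮⇒≥ t≮r) t<s)) | ≡ᵇ-false (<⇒≢ (≤-<-trans (≮⇒≥ t≮r) t<s) ∘ sym) = a<x<b
    ... | no  t≮r | no  t≮s rewrite <ᵇ-false (≮⇒≥ t≮r) | <ᵇ-false (≮⇒≥ t≮s) = both

    data SameDescents : Word → Word → Set where
      []     : SameDescents [] []
      single : ∀ {x x'} → SameDescents (x ∷ []) (x' ∷ [])
      _∷_    : ∀ {x y w x' y' w'} → gtC c x y ≡ gtC c x' y' →
               SameDescents (y ∷ w) (y' ∷ w') → SameDescents (x ∷ y ∷ w) (x' ∷ y' ∷ w')

    majFrom-same : ∀ {w w'} i → SameDescents w w' → majFrom c i w ≡ majFrom c i w'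
    majFrom-same i []       = refl
    majFrom-same i single   = refl
    majFrom-same i (eq ∷ p) = cong₂ (λ g m → (if g then i else 0) ℕ.+ m) eq (majFrom-same (suc i) p)

    same-refl : ∀ w → SameDescents w w
    same-refl []          = []
    same-refl (x ∷ [])    = single
    same-refl (x ∷ y ∷ w) = refl ∷ same-refl (y ∷ w)

    same-suffix : ∀ {n x y} t {z} → n < x → n < y → Small n z → SameDescents ((x , t) ∷ z) ((y , t) ∷ z)
    same-suffix t n<x n<y [] = single
    same-suffix t {(b , s) ∷ z} n<x n<y (b≤n ∷ sz) =
      trans (large>small t s (≤-<-trans b≤n n<x)) (sym (large>small t s (≤-<-trans b≤n n<y))) ∷ same-refl _

    same-prefix : ∀ {n x y} t {u w w'} → n < x → n < y → Small n u →
      SameDescents ((x , t) ∷ w) ((y , t) ∷ w') → SameDescents (u ++ (x , t) ∷ w) (u ++ (y , t) ∷ w')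
    same-prefix t n<x n<y [] p = p
    same-prefix t n<x n<y (_∷_ {x = b , s} b≤n []) p =
      trans (small>large t s (≤-<-trans b≤n n<x)) (sym (small>large t s (≤-<-trans b≤n n<y))) ∷ p
    same-prefix t n<x n<y (_ ∷ su@(_ ∷ _)) p = refl ∷ same-prefix t n<x n<y su p

    -- Next to a small letter only the color of a large letter matters, and the colors stay in
    -- place. The large letters meet each other only if v is empty, and then their different colors
    -- decide the comparison.
    same-swap : ∀ {n x y t s u v z} → n < x → n < y → t < c → s < c → ¬ (v ≡ []) ⊎ ¬ (t ≡ s) →
      Small n u → Small n v → Small n z →
      SameDescents (u ++ (x , t) ∷ v ++ (y , s) ∷ z) (u ++ (y , t) ∷ v ++ (x , s) ∷ z)
    same-swap {n} {x} {y} {t} {s} {v = v} {z} n<x n<y t<c s<c separated su sv sz =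
      same-prefix t n<x n<y su (middle separated sv)
      where
      middle : ∀ {v} → ¬ (v ≡ []) ⊎ ¬ (t ≡ s) → Small n v →
        SameDescents ((x , t) ∷ v ++ (y , s) ∷ z) ((y , t) ∷ v ++ (x , s) ∷ z)
      middle (inj₁ v≢[]) [] = contradiction refl v≢[]
      middle (inj₂ t≢s)  [] = gtC-relabel x y y x s<c t<c t≢s ∷ same-suffix s n<y n<x sz
      middle _ sv@(_∷_ {x = b , r} b≤n _) =
        trans (large>small t r (≤-<-trans b≤n n<x)) (sym (large>small t r (≤-<-trans b≤n n<y)))
        ∷ same-prefix s n<y n<x sv (same-suffix s n<y n<x sz)

    des : Word → ℕ
    des []          = 0
    des (x ∷ [])    = 0
    des (x ∷ y ∷ w) = (if gtC c x y then 1 else 0) ℕ.+ des (y ∷ w)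

    -- Moving every position by one adds one for each descent.
    majFrom-shift : ∀ i w → majFrom c (suc i) w ≡ des w ℕ.+ majFrom c i w
    majFrom-shift i []          = refl
    majFrom-shift i (x ∷ [])    = refl
    majFrom-shift i (x ∷ y ∷ w) with gtC c x y | majFrom-shift (suc i) (y ∷ w)
    ... | true  | eq = cong suc (trans (cong (i ℕ.+_) eq) (x∙yz≈y∙xz i (des (y ∷ w)) _))
    ... | false | eq = eq

open Words

-- Finite sums over lists and over the gaps of a word.

insertions-length : ∀ x σ → All (λ τ → length τ ≡ suc (length σ)) (insertions x σ)
insertions-length x []      = ≡.refl ∷ []
insertions-length x (y ∷ σ) = ≡.refl ∷ map⁺ (All.map (≡.cong suc) (insertions-length x σ))

perms-length : ∀ n → All (λ σ → length σ ≡ n) (perms n)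
perms-length zero    = ≡.refl ∷ []
perms-length (suc n) = concat⁺ (map⁺ (All.map
  (λ {σ} |σ|≡n → All.map (λ eq → ≡.trans eq (≡.cong suc |σ|≡n)) (insertions-length (suc n) σ))
  (perms-length n)))

module Sums {a ℓ} (R : CommutativeRing a ℓ) where
  open CommutativeRing R
  open RingExpr R
  open import Relation.Binary.Reasoning.Setoid setoid
  open Algebra.Properties.CommutativeSemigroup +-commutativeSemigroup using (interchange)

  ∑ : {A : Set} → List A → (A → Carrier) → Carrier
  ∑ xs f = sumR (map f xs)

  ∑-++ : {A : Set} (xs ys : List A) (f : A → Carrier) → ∑ (xs ++ ys) f ≈ ∑ xs f + ∑ ys f
  ∑-++ []       ys f = sym (+-identityˡ _)
  ∑-++ (x ∷ xs) ys f = trans (+-congˡ (∑-++ xs ys f)) (sym (+-assoc _ _ _))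

  ∑-map : {A B : Set} (h : A → B) (xs : List A) (f : B → Carrier) → ∑ (map h xs) f ≈ ∑ xs (λ x → f (h x))
  ∑-map h []       f = refl
  ∑-map h (x ∷ xs) f = +-congˡ (∑-map h xs f)

  ∑-concatMap : {A B : Set} (h : A → List B) (xs : List A) (f : B → Carrier) →
    ∑ (concatMap h xs) f ≈ ∑ xs (λ x → ∑ (h x) f)
  ∑-concatMap h []       f = refl
  ∑-concatMap h (x ∷ xs) f = trans (∑-++ (h x) _ f) (+-congˡ (∑-concatMap h xs f))

  ∑-congᴬ : {A : Set} {xs : List A} {f g : A → Carrier} → All (λ x → f x ≈ g x) xs → ∑ xs f ≈ ∑ xs g
  ∑-congᴬ []       = refl
  ∑-congᴬ (p ∷ ps) = +-cong p (∑-congᴬ ps)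

  ∑-cong : {A : Set} (xs : List A) {f g : A → Carrier} → (∀ x → f x ≈ g x) → ∑ xs f ≈ ∑ xs g
  ∑-cong xs p = ∑-congᴬ (All.universal p xs)

  ∑-zero : {A : Set} (xs : List A) → ∑ xs (λ _ → 0#) ≈ 0#
  ∑-zero []       = refl
  ∑-zero (x ∷ xs) = trans (+-identityˡ _) (∑-zero xs)

  ∑-+ : {A : Set} (xs : List A) (f g : A → Carrier) → ∑ xs (λ x → f x + g x) ≈ ∑ xs f + ∑ xs g
  ∑-+ []       f g = sym (+-identityˡ _)
  ∑-+ (x ∷ xs) f g = trans (+-congˡ (∑-+ xs f g)) (interchange _ _ _ _)

  ∑-*ʳ : {A : Set} (xs : List A) (f : A → Carrier) (k : Carrier) → ∑ xs (λ x → f x * k) ≈ ∑ xs f * k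
  ∑-*ʳ []       f k = sym (zeroˡ k)
  ∑-*ʳ (x ∷ xs) f k = trans (+-congˡ (∑-*ʳ xs f k)) (sym (distribʳ k _ _))

  ∑-comm : {A B : Set} (xs : List A) (ys : List B) (f : A → B → Carrier) →
    ∑ xs (λ x → ∑ ys (f x)) ≈ ∑ ys (λ y → ∑ xs (λ x → f x y))
  ∑-comm []       ys f = sym (∑-zero ys)
  ∑-comm (x ∷ xs) ys f = trans (+-congˡ (∑-comm xs ys f)) (sym (∑-+ ys (f x) _))

  -- `AllPairs` meets each pair of positions once, in list order, so the hypothesis has to make both
  -- mirror entries vanish. Peeling off the head then removes its row and its column.
  ∑-diagonal : {A : Set} {xs : List A} (g : A → A → Carrier) →
    AllPairs (λ x y → g x y ≈ 0# × g y x ≈ 0#) xs → ∑ xs (λ x → ∑ xs (g x)) ≈ ∑ xs (λ x → g x x)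
  ∑-diagonal g [] = refl
  ∑-diagonal {xs = x ∷ xs} g (p ∷ ps) = +-cong
    (trans (+-congˡ (trans (∑-congᴬ (All.map proj₁ p)) (∑-zero xs))) (+-identityʳ _))
    (begin
      ∑ xs (λ y → g y x + ∑ xs (g y))          ≈⟨ ∑-congᴬ (All.map (λ z → trans (+-congʳ (proj₂ z)) (+-identityˡ _)) p) ⟩
      ∑ xs (λ y → ∑ xs (g y))                  ≈⟨ ∑-diagonal g ps ⟩
      ∑ xs (λ y → g y y)                       ∎)

  ∑-pow : ∀ k x → ∑ (upTo k) (pow x) ≈ qint k x
  ∑-pow zero    x = refl
  ∑-pow (suc k) x = +-congˡ (begin
    ∑ (applyUpTo suc k) (pow x)  ≡⟨ ≡.cong (λ ys → ∑ ys (pow x)) (map-upTo suc k) ⟨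
    ∑ (map suc (upTo k)) (pow x)           ≈⟨ ∑-map suc (upTo k) (pow x) ⟩
    ∑ (upTo k) (λ t → x * pow x t)         ≈⟨ ∑-cong (upTo k) (λ t → *-comm x _) ⟩
    ∑ (upTo k) (λ t → pow x t * x)         ≈⟨ ∑-*ʳ (upTo k) (pow x) x ⟩
    ∑ (upTo k) (pow x) * x                 ≈⟨ *-comm _ x ⟩
    x * ∑ (upTo k) (pow x)                 ≈⟨ *-congˡ (∑-pow k x) ⟩
    x * qint k x                           ∎)

  -- The sum over all `length w + 1` ways to cut w into u ++ v, that is, over the gaps in which
  -- letters can be inserted.
  gapΣ : {A : Set} → (List A → List A → Carrier) → List A → Carrier
  gapΣ h []      = h [] []
  gapΣ h (x ∷ w) = h [] (x ∷ w) + gapΣ (λ u v → h (x ∷ u) v) w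

  module _ {A : Set} where

    gapΣ-cong : ∀ {g h : List A → List A → Carrier} w →
      (∀ u v → u ++ v ≡ w → g u v ≈ h u v) → gapΣ g w ≈ gapΣ h w
    gapΣ-cong []      p = p [] [] ≡.refl
    gapΣ-cong (x ∷ w) p = +-cong (p [] (x ∷ w) ≡.refl) (gapΣ-cong w (λ u v eq → p (x ∷ u) v (≡.cong (x ∷_) eq)))

    gapΣ-+ : ∀ (g h : List A → List A → Carrier) w → gapΣ (λ u v → g u v + h u v) w ≈ gapΣ g w + gapΣ h w
    gapΣ-+ g h []      = refl
    gapΣ-+ g h (x ∷ w) = trans (+-congˡ (gapΣ-+ _ _ w)) (interchange _ _ _ _)

    gapΣ-*ˡ : ∀ k (h : List A → List A → Carrier) w → gapΣ (λ u v → k * h u v) w ≈ k * gapΣ h w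
    gapΣ-*ˡ k h []      = refl
    gapΣ-*ˡ k h (x ∷ w) = trans (+-congˡ (gapΣ-*ˡ k _ w)) (sym (distribˡ k _ _))

    gapΣ-∑ : ∀ {B : Set} (xs : List B) (h : B → List A → List A → Carrier) w →
      gapΣ (λ u v → ∑ xs (λ x → h x u v)) w ≈ ∑ xs (λ x → gapΣ (h x) w)
    gapΣ-∑ xs h []      = refl
    gapΣ-∑ xs h (y ∷ w) = trans (+-congˡ (gapΣ-∑ xs _ w)) (sym (∑-+ xs _ _))

    gapΣ-zero : ∀ {h : List A → List A → Carrier} w → (∀ u v → u ++ v ≡ w → h u v ≈ 0#) → gapΣ h w ≈ 0#
    gapΣ-zero []      p = p [] [] ≡.refl
    gapΣ-zero (x ∷ w) p = trans (+-cong (p [] (x ∷ w) ≡.refl) (gapΣ-zero w (λ u v eq → p (x ∷ u) v (≡.cong (x ∷_) eq))))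
      (+-identityˡ 0#)

  insertΣ : {A : Set} → A → List A → (List A → Carrier) → Carrier
  insertΣ x w f = gapΣ (λ u v → f (u ++ x ∷ v)) w

  -- Recursion for sums over colored permutations.

  module Enumeration (c : ℕ) where

    ∑-colorings-suc : ∀ n (f : List ℕ → Carrier) →
      ∑ (colorings c (suc n)) f ≈ ∑ (colorings c n) (λ ts → ∑ (upTo c) (λ t → f (t ∷ ts)))
    ∑-colorings-suc n f = trans (∑-concatMap _ (colorings c n) f)
      (∑-cong (colorings c n) (λ ts → ∑-map (_∷ ts) (upTo c) f))

    -- Inserting x and then coloring everything yields the same words as coloring σ and then
    -- inserting a colored x. Only the order of the sums differs, so the work is to commute them.
    ∑-insertions : ∀ x {n} σ → length σ ≡ n → (f : Word → Carrier) →
      ∑ (insertions x σ) (λ τ → ∑ (colorings c (suc n)) (λ ts → f (zipW τ ts)))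
      ≈ ∑ (colorings c n) (λ ts → ∑ (upTo c) (λ t → insertΣ (x , t) (zipW σ ts) f))
    ∑-insertions x []      ≡.refl f = trans (+-identityʳ _) (∑-colorings-suc 0 _)
    ∑-insertions x (y ∷ σ) ≡.refl f = begin
      ∑ (colorings c (2 ℕ.+ n)) (λ ts → f (zipW (x ∷ y ∷ σ) ts))
        + ∑ (map (y ∷_) (insertions x σ)) (λ τ → ∑ (colorings c (2 ℕ.+ n)) (λ ts → f (zipW τ ts)))
        ≈⟨ +-cong (trans (∑-colorings-suc (suc n) _) (∑-colorings-suc n _))
             (trans (∑-map (y ∷_) (insertions x σ) _)
               (trans (∑-cong (insertions x σ) (λ τ → ∑-colorings-suc (suc n) _))
                 (∑-insertions x σ ≡.refl f′))) ⟩
      ∑ (colorings c n) (λ ts → ∑ (upTo c) (λ s → ∑ (upTo c) (λ t → f ((x , t) ∷ (y , s) ∷ zipW σ ts))))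
        + ∑ (colorings c n) (λ ts → ∑ (upTo c) (λ t → insertΣ (x , t) (zipW σ ts) f′))
        ≈⟨ ∑-+ (colorings c n) _ _ ⟨
      ∑ (colorings c n) (λ ts → ∑ (upTo c) (λ s → ∑ (upTo c) (λ t → f ((x , t) ∷ (y , s) ∷ zipW σ ts)))
        + ∑ (upTo c) (λ t → insertΣ (x , t) (zipW σ ts) f′))
        ≈⟨ ∑-cong (colorings c n) (λ ts → +-congˡ (trans
             (∑-cong (upTo c) (λ t → gapΣ-∑ (upTo c) _ (zipW σ ts)))
             (∑-comm (upTo c) (upTo c) _))) ⟩
      ∑ (colorings c n) (λ ts → ∑ (upTo c) (λ s → ∑ (upTo c) (λ t → f ((x , t) ∷ (y , s) ∷ zipW σ ts)))
        + ∑ (upTo c) (λ s → ∑ (upTo c) (λ t → insertΣ (x , t) (zipW σ ts) (λ w → f ((y , s) ∷ w)))))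
        ≈⟨ ∑-cong (colorings c n) (λ ts → trans
             (∑-cong (upTo c) (λ s → ∑-+ (upTo c) _ _)) (∑-+ (upTo c) _ _)) ⟨
      ∑ (colorings c n) (λ ts → ∑ (upTo c) (λ s → ∑ (upTo c) (λ t → insertΣ (x , t) ((y , s) ∷ zipW σ ts) f)))
        ≈⟨ ∑-colorings-suc n _ ⟨
      ∑ (colorings c (suc n)) (λ ts → ∑ (upTo c) (λ t → insertΣ (x , t) (zipW (y ∷ σ) ts) f)) ∎
      where
      n = length σ
      -- The color of the head y is summed inside the function, so that the induction hypothesis
      -- applies to σ alone.
      f′ : Word → Carrier
      f′ w = ∑ (upTo c) (λ s → f ((y , s) ∷ w))

    ∑-G : ∀ n (f : Word → Carrier) →
      ∑ (G c n) f ≈ ∑ (perms n) (λ σ → ∑ (colorings c n) (λ ts → f (zipW σ ts)))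
    ∑-G n f = trans (∑-concatMap _ (perms n) f) (∑-cong (perms n) (λ σ → ∑-map (zipW σ) (colorings c n) f))

    ∑-G-suc : ∀ n (f : Word → Carrier) →
      ∑ (G c (suc n)) f ≈ ∑ (G c n) (λ w → ∑ (upTo c) (λ t → insertΣ (suc n , t) w f))
    ∑-G-suc n f = begin
      ∑ (G c (suc n)) f
        ≈⟨ ∑-G (suc n) f ⟩
      ∑ (perms (suc n)) (λ τ → ∑ (colorings c (suc n)) (λ ts → f (zipW τ ts)))
        ≈⟨ ∑-concatMap (insertions (suc n)) (perms n) _ ⟩
      ∑ (perms n) (λ σ → ∑ (insertions (suc n) σ) (λ τ → ∑ (colorings c (suc n)) (λ ts → f (zipW τ ts))))
        ≈⟨ ∑-congᴬ (All.map (λ {σ} |σ|≡n → ∑-insertions (suc n) σ |σ|≡n f) (perms-length n)) ⟩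
      ∑ (perms n) (λ σ → ∑ (colorings c n) (λ ts → ∑ (upTo c) (λ t → insertΣ (suc n , t) (zipW σ ts) f)))
        ≈⟨ ∑-G n _ ⟨
      ∑ (G c n) (λ w → ∑ (upTo c) (λ t → insertΣ (suc n , t) w f)) ∎

    -- The bound on the letters and the length are carried along the insertion recursion, so no
    -- membership in `G c n` has to be analysed.
    ∑-G-cong : ∀ n {f g : Word → Carrier} →
      (∀ w → Small n w → length w ≡ n → f w ≈ g w) → ∑ (G c n) f ≈ ∑ (G c n) g
    ∑-G-cong zero    p = +-congʳ (p [] [] ≡.refl)
    ∑-G-cong (suc n) {f} {g} p = begin
      ∑ (G c (suc n)) f ≈⟨ ∑-G-suc n f ⟩
      _                 ≈⟨ ∑-G-cong n (λ w sw |w|≡n → ∑-cong (upTo c) (λ t → gapΣ-cong w (λ u v eq → inserted t u v eq sw |w|≡n))) ⟩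
      _                 ≈⟨ ∑-G-suc n g ⟨
      ∑ (G c (suc n)) g ∎
      where
      inserted : ∀ {w} t u v → u ++ v ≡ w → Small n w → length w ≡ n → f (u ++ (suc n , t) ∷ v) ≈ g (u ++ (suc n , t) ∷ v)
      inserted t u v ≡.refl sw |w|≡n with ++⁻ u (All.map (λ x≤n → ≤-trans x≤n (n≤1+n n)) sw)
      ... | su , sv = p _ (++⁺ su (≤-refl ∷ sv))
        (≡.trans (length-++ u) (≡.trans (ℕₚ.+-suc (length u) _) (≡.cong suc (≡.trans (≡.sym (length-++ u)) |w|≡n))))

-- Powers, signs and q-integers.

module Powers {a ℓ} (R : CommutativeRing a ℓ) where
  open CommutativeRing R
  open RingExpr R
  open Algebra.Properties.Ring ring
  open import Relation.Binary.Reasoning.Setoid setoid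
  open Algebra.Properties.CommutativeSemigroup *-commutativeSemigroup using (interchange)
  open Algebra.Solver.Ring.NaturalCoefficients.Default commutativeSemiring

  pow-cong : ∀ {x y} k → x ≈ y → pow x k ≈ pow y k
  pow-cong zero    x≈y = refl
  pow-cong (suc k) x≈y = *-cong x≈y (pow-cong k x≈y)

  pow-+ : ∀ x m n → pow x (m ℕ.+ n) ≈ pow x m * pow x n
  pow-+ x zero    n = sym (*-identityˡ _)
  pow-+ x (suc m) n = trans (*-congˡ (pow-+ x m n)) (sym (*-assoc _ _ _))

  pow-* : ∀ x m n → pow x (m ℕ.* n) ≈ pow (pow x m) n
  pow-* x m zero    = reflexive (≡.cong (pow x) (ℕₚ.*-zeroʳ m))
  pow-* x m (suc n) = begin
    pow x (m ℕ.* suc n)         ≡⟨ ≡.cong (pow x) (ℕₚ.*-suc m n) ⟩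
    pow x (m ℕ.+ m ℕ.* n)       ≈⟨ pow-+ x m _ ⟩
    pow x m * pow x (m ℕ.* n)   ≈⟨ *-congˡ (pow-* x m n) ⟩
    pow x m * pow (pow x m) n   ∎

  pow-product : ∀ x y k → pow (x * y) k ≈ pow x k * pow y k
  pow-product x y zero    = sym (*-identityˡ _)
  pow-product x y (suc k) = trans (*-congˡ (pow-product x y k)) (interchange _ _ _ _)

  pow-double : ∀ x k → pow x (k ℕ.+ k) ≈ pow (x * x) k
  pow-double x k = trans (pow-+ x k k) (sym (pow-product x x k))

  pow-one : ∀ k → pow 1# k ≈ 1#
  pow-one zero    = refl
  pow-one (suc k) = trans (*-identityˡ _) (pow-one k)

  -x*-x≈x*x : ∀ x → - x * - x ≈ x * x
  -x*-x≈x*x x = begin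
    - x * - x    ≈⟨ -‿distribˡ-* x (- x) ⟨
    - (x * - x)  ≈⟨ -‿cong (-‿distribʳ-* x x) ⟨
    - - (x * x)  ≈⟨ -‿involutive _ ⟩
    x * x        ∎

  pow-neg-double : ∀ x k → pow (- x) (k ℕ.+ k) ≈ pow x (k ℕ.+ k)
  pow-neg-double x k = trans (pow-double (- x) k) (trans (pow-cong k (-x*-x≈x*x x)) (sym (pow-double x k)))

  pow-neg-even : ∀ x {m} → 2 ∣ m → pow (- x) m ≈ pow x m
  pow-neg-even x {m} (divides h ≡.refl) = ≡.subst (λ m → pow (- x) m ≈ pow x m) h+h≡h*2 (pow-neg-double x h)
    where
    h+h≡h*2 : h ℕ.+ h ≡ h ℕ.* 2
    h+h≡h*2 = ≡.trans (≡.cong (h ℕ.+_) (≡.sym (ℕₚ.+-identityʳ h))) (ℕₚ.*-comm 2 h)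

  neg-one-even : ∀ {m} → 2 ∣ m → pow (- 1#) m ≈ 1#
  neg-one-even {m} 2∣m = trans (pow-neg-even 1# 2∣m) (pow-one m)

  neg-one-double : ∀ k → pow (- 1#) (k ℕ.+ k) ≈ 1#
  neg-one-double k = trans (pow-neg-double 1# k) (pow-one (k ℕ.+ k))

  pow-neg : ∀ x k → pow (- x) k ≈ pow (- 1#) k * pow x k
  pow-neg x k = trans (pow-cong k (sym (-1*x≈-x x))) (pow-product (- 1#) x k)

  pow-diff : ∀ x j k → pow x k + - pow x (j ℕ.+ k) ≈ pow x k * (1# + - pow x j)
  pow-diff x j k = begin
    pow x k + - pow x (j ℕ.+ k)         ≈⟨ +-cong (sym (*-identityʳ _)) (-‿cong (trans (pow-+ x j k) (*-comm _ _))) ⟩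
    pow x k * 1# + - (pow x k * pow x j) ≈⟨ +-congˡ (-‿distribʳ-* _ _) ⟩
    pow x k * 1# + pow x k * - pow x j   ≈⟨ distribˡ _ _ _ ⟨
    pow x k * (1# + - pow x j)           ∎

  pow-+-diff : ∀ x i j k → pow x (i ℕ.+ j) + - pow x (i ℕ.+ k) ≈ pow x i * (pow x j + - pow x k)
  pow-+-diff x i j k = begin
    pow x (i ℕ.+ j) + - pow x (i ℕ.+ k)              ≈⟨ +-cong (pow-+ x i j) (-‿cong (pow-+ x i k)) ⟩
    pow x i * pow x j + - (pow x i * pow x k)        ≈⟨ +-congˡ (-‿distribʳ-* _ _) ⟩
    pow x i * pow x j + pow x i * - pow x k          ≈⟨ distribˡ _ _ _ ⟨
    pow x i * (pow x j + - pow x k)                  ∎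

  cancel-middle : ∀ x y z → (x + - y) + (y + z) ≈ x + z
  cancel-middle x y z = begin
    -- The solver is one for commutative semirings, so `- y` enters as an independent variable and
    -- is cancelled afterwards.
    (x + - y) + (y + z)  ≈⟨ solve 4 (λ x y′ y z → (x :+ y′) :+ (y :+ z) := (y′ :+ y) :+ (x :+ z)) refl x (- y) y z ⟩
    (- y + y) + (x + z)  ≈⟨ +-congʳ (-‿inverseˡ y) ⟩
    0# + (x + z)         ≈⟨ +-identityˡ _ ⟩
    x + z                ∎

  qint-cong : ∀ {x y} k → x ≈ y → qint k x ≈ qint k y
  qint-cong zero    x≈y = refl
  qint-cong (suc k) x≈y = +-congˡ (*-cong x≈y (qint-cong k x≈y))

  qint-+ : ∀ j k x → qint (j ℕ.+ k) x ≈ qint j x + pow x j * qint k x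
  qint-+ zero    k x = solve 1 (λ y → y := con 0 :+ con 1 :* y) refl (qint k x)
  qint-+ (suc j) k x = trans (+-congˡ (*-congˡ (qint-+ j k x)))
    (solve 4 (λ x a b c → con 1 :+ x :* (a :+ b :* c) := (con 1 :+ x :* a) :+ (x :* b) :* c) refl x (qint j x) (pow x j) (qint k x))

  -- Groups the exponents below jk by quotient and remainder modulo j.
  qint-* : ∀ j k x → qint (j ℕ.* k) x ≈ qint j x * qint k (pow x j)
  qint-* j zero    x = trans (reflexive (≡.cong (λ m → qint m x) (ℕₚ.*-zeroʳ j))) (sym (zeroʳ _))
  qint-* j (suc k) x = begin
    qint (j ℕ.* suc k) x                                ≡⟨ ≡.cong (λ m → qint m x) (ℕₚ.*-suc j k) ⟩
    qint (j ℕ.+ j ℕ.* k) x                              ≈⟨ qint-+ j _ x ⟩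
    qint j x + pow x j * qint (j ℕ.* k) x               ≈⟨ +-congˡ (*-congˡ (qint-* j k x)) ⟩
    qint j x + pow x j * (qint j x * qint k (pow x j))
      ≈⟨ solve 3 (λ a b c → a :+ b :* (a :* c) := a :* (con 1 :+ b :* c)) refl (qint j x) (pow x j) (qint k (pow x j)) ⟩
    qint j x * qint (suc k) (pow x j)                   ∎

  qint-geometric : ∀ x k → (1# + - x) * qint k x ≈ 1# + - pow x k
  qint-geometric x zero    = trans (zeroʳ _) (sym (-‿inverseʳ 1#))
  qint-geometric x (suc k) = begin
    (1# + - x) * (1# + x * qint k x)
      ≈⟨ solve 3 (λ x m s → (con 1 :+ m) :* (con 1 :+ x :* s) := (con 1 :+ m) :+ x :* ((con 1 :+ m) :* s)) refl x (- x) (qint k x) ⟩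
    (1# + - x) + x * ((1# + - x) * qint k x)   ≈⟨ +-congˡ (*-congˡ (qint-geometric x k)) ⟩
    (1# + - x) + x * (1# + - pow x k)          ≈⟨ +-congˡ (trans (distribˡ _ _ _) (+-cong (*-identityʳ x) (sym (-‿distribʳ-* _ _)))) ⟩
    (1# + - x) + (x + - (x * pow x k))         ≈⟨ cancel-middle _ _ _ ⟩
    1# + - (x * pow x k)                       ∎

  -- The division-free factor of a block.

  module Block (Q : Carrier) where

    U : ℕ → Carrier
    U p = 1# + - pow Q (suc p)

    -- B p = (1 - Q^p)(1 - Q^(p+1)) / (1 - Q²), defined without division.
    B : ℕ → Carrier
    B zero    = 0#
    B (suc p) = B p + pow Q p * U p

    -- Both sides equal 1 - Q^(2p+3).
    U-exchange : ∀ p → U (suc p) + pow Q (2 ℕ.+ p) * U p ≈ U p + pow Q (suc p) * U (suc p)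
    U-exchange p = begin
      U (suc p) + pow Q (2 ℕ.+ p) * U p              ≈⟨ +-congˡ (pow-diff Q (suc p) (2 ℕ.+ p)) ⟨
      U (suc p) + (pow Q (2 ℕ.+ p) + - pow Q (suc p ℕ.+ (2 ℕ.+ p)))  ≈⟨ cancel-middle _ _ _ ⟩
      1# + - pow Q (suc p ℕ.+ (2 ℕ.+ p))             ≡⟨ ≡.cong (λ m → 1# + - pow Q m) (ℕₚ.+-comm (suc p) (2 ℕ.+ p)) ⟩
      1# + - pow Q ((2 ℕ.+ p) ℕ.+ suc p)             ≈⟨ cancel-middle _ _ _ ⟨
      U p + (pow Q (suc p) + - pow Q ((2 ℕ.+ p) ℕ.+ suc p)) ≈⟨ +-congˡ (pow-diff Q (2 ℕ.+ p) (suc p)) ⟩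
      U p + pow Q (suc p) * U (suc p)                ∎

    -- `B p` is 1 - Q times the Gaussian binomial coefficient of p+1 over 2. Its definition is one
    -- of the two q-Pascal rules, and this is the other.
    B-suc : ∀ p → B (suc p) ≈ U p + Q * Q * B p
    B-suc zero    = solve 2 (λ Q u → con 0 :+ con 1 :* u := u :+ Q :* Q :* con 0) refl Q (U 0)
    B-suc (suc p) = begin
      B (suc p) + pow Q (suc p) * U (suc p)                       ≈⟨ +-congʳ (B-suc p) ⟩
      (U p + Q * Q * B p) + pow Q (suc p) * U (suc p)
        ≈⟨ solve 3 (λ u b e → (u :+ b) :+ e := b :+ (u :+ e)) refl (U p) (Q * Q * B p) _ ⟩
      Q * Q * B p + (U p + pow Q (suc p) * U (suc p))             ≈⟨ +-congˡ (U-exchange p) ⟨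
      Q * Q * B p + (U (suc p) + pow Q (2 ℕ.+ p) * U p)
        ≈⟨ solve 5 (λ Q b v P u → Q :* Q :* b :+ (v :+ (Q :* (Q :* P)) :* u) := v :+ Q :* Q :* (b :+ P :* u)) refl Q (B p) (U (suc p)) (pow Q p) (U p) ⟩
      U (suc p) + Q * Q * B (suc p)                               ∎

    -- Of the factors 1 - Q^p and 1 - Q^(p+1), the one with even exponent is 1 - Q² times a
    -- q-integer in Q². This gives the quotient without division. Each parity is reached from the
    -- other.
    B-even : ∀ j → B (j ℕ.+ j) ≈ U (j ℕ.+ j) * qint j (Q * Q)
    B-odd  : ∀ j → B (suc (j ℕ.+ j)) ≈ U (j ℕ.+ j) * qint (suc j) (Q * Q)
    B-odd j = begin
      B (suc (j ℕ.+ j))                                   ≈⟨ B-suc (j ℕ.+ j) ⟩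
      U (j ℕ.+ j) + Q * Q * B (j ℕ.+ j)                   ≈⟨ +-congˡ (*-congˡ (B-even j)) ⟩
      U (j ℕ.+ j) + Q * Q * (U (j ℕ.+ j) * qint j (Q * Q))
        ≈⟨ solve 3 (λ u r s → u :+ r :* (u :* s) := u :* (con 1 :+ r :* s)) refl (U (j ℕ.+ j)) (Q * Q) (qint j (Q * Q)) ⟩
      U (j ℕ.+ j) * qint (suc j) (Q * Q)                  ∎
    B-even zero    = sym (zeroʳ _)
    B-even (suc j) rewrite ℕₚ.+-suc j j = begin
      B (suc m) + pow Q (suc m) * U (suc m)
        ≈⟨ +-cong (B-odd j) (*-congˡ U-geometric) ⟩
      U m * s + pow Q (suc m) * ((1# + - (Q * Q)) * s)
        ≈⟨ solve 4 (λ u s P v → u :* s :+ P :* (v :* s) := (u :+ P :* v) :* s) refl (U m) s (pow Q (suc m)) _ ⟩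
      (U m + pow Q (suc m) * (1# + - (Q * Q))) * s
        ≈⟨ *-congʳ (+-congˡ (trans (*-congˡ (+-congˡ (-‿cong (*-congˡ (sym (*-identityʳ Q)))))) (sym (pow-diff Q 2 (suc m))))) ⟩
      (U m + (pow Q (suc m) + - pow Q (3 ℕ.+ m))) * s
        ≈⟨ *-congʳ (cancel-middle _ _ _) ⟩
      U (2 ℕ.+ m) * s ∎
      where
      m = j ℕ.+ j
      s = qint (suc j) (Q * Q)
      U-geometric : U (suc m) ≈ (1# + - (Q * Q)) * s
      U-geometric = begin
        1# + - pow Q (2 ℕ.+ m)              ≡⟨ ≡.cong (λ k → 1# + - pow Q (suc k)) (ℕₚ.+-suc j j) ⟨
        1# + - pow Q (suc j ℕ.+ suc j)      ≈⟨ +-congˡ (-‿cong (pow-double Q (suc j))) ⟩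
        1# + - pow (Q * Q) (suc j)          ≈⟨ qint-geometric (Q * Q) (suc j) ⟨
        (1# + - (Q * Q)) * s                ∎

-- Cancellation of exchanged pairs of large letters.

module Pairing {a ℓ} (R : CommutativeRing a ℓ) (c n : ℕ) where
  open CommutativeRing R
  open Sums R
  open import Relation.Binary.Reasoning.Setoid setoid
  open Algebra.Solver.Ring.NaturalCoefficients.Default commutativeSemiring using (solve; _:=_; _:+_)

  A B : ℕ → ℕ × ℕ
  A t = suc n , t
  B t = 2 ℕ.+ n , t

  -- The condition leaves out only adjacent letters of one color. With an arbitrary prefix u, the
  -- property passes from f to `f ∘ (y ∷_)`.
  Antisymmetric : (Word → Carrier) → Set ℓ
  Antisymmetric f = ∀ {t s u v z} → t < c → s < c → ¬ (v ≡ []) ⊎ ¬ (t ≡ s) →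
    Small n u → Small n v → Small n z →
    f (u ++ A t ∷ v ++ B s ∷ z) + f (u ++ B t ∷ v ++ A s ∷ z) ≈ 0#

  -- An exchange fixes the colors of the positions, whereas the insertions index colors by letter.
  -- Renaming the colors in one summand reconciles the two.
  ∑-transpose : ∀ (h k : ℕ → ℕ → Carrier) →
    ∑ (upTo c) (λ t → ∑ (upTo c) (λ s → k t s + h s t)) ≈ ∑ (upTo c) (λ t → ∑ (upTo c) (λ s → k t s + h t s))
  ∑-transpose h k = begin
    ∑ (upTo c) (λ t → ∑ (upTo c) (λ s → k t s + h s t))   ≈⟨ split (λ t s → h s t) ⟩
    ∑ (upTo c) (λ t → ∑ (upTo c) (k t)) + ∑ (upTo c) (λ t → ∑ (upTo c) (λ s → h s t)) ≈⟨ +-congˡ (∑-comm (upTo c) (upTo c) _) ⟩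
    ∑ (upTo c) (λ t → ∑ (upTo c) (k t)) + ∑ (upTo c) (λ t → ∑ (upTo c) (h t))         ≈⟨ split h ⟨
    ∑ (upTo c) (λ t → ∑ (upTo c) (λ s → k t s + h t s))   ∎
    where
    split : ∀ h → ∑ (upTo c) (λ t → ∑ (upTo c) (λ s → k t s + h t s))
                  ≈ ∑ (upTo c) (λ t → ∑ (upTo c) (k t)) + ∑ (upTo c) (λ t → ∑ (upTo c) (h t))
    split h = trans (∑-cong (upTo c) (λ t → ∑-+ (upTo c) (k t) (h t))) (∑-+ (upTo c) _ _)

  adjacent : ∀ {z} → Small n z → (f : Word → Carrier) → Antisymmetric f →
    ∑ (upTo c) (λ t → ∑ (upTo c) (λ s → f (A t ∷ B s ∷ z) + f (B s ∷ A t ∷ z)))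
    ≈ ∑ (upTo c) (λ t → f (A t ∷ B t ∷ z) + f (B t ∷ A t ∷ z))
  adjacent sz f anti = trans (∑-transpose _ _) (∑-diagonal _ (AllPairs.applyUpTo⁺₁ _ c λ i<j j<c →
    anti (ℕₚ.<-trans i<j j<c) j<c (inj₂ (ℕₚ.<⇒≢ i<j)) [] [] sz ,
    anti j<c (ℕₚ.<-trans i<j j<c) (inj₂ (ℕₚ.<⇒≢ i<j ∘ ≡.sym)) [] [] sz))

  -- With y between them the large letters are never adjacent, so every term cancels, whatever the
  -- colors.
  separated : ∀ {y w} → Small n (y ∷ w) → (f : Word → Carrier) → Antisymmetric f →
    ∑ (upTo c) (λ t → ∑ (upTo c) (λ s →
      insertΣ (B s) w (λ w′ → f (A t ∷ y ∷ w′)) + insertΣ (A t) w (λ w′ → f (B s ∷ y ∷ w′)))) ≈ 0#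
  separated {y} {w} (sy ∷ sw) f anti = trans (∑-transpose _ _) (vanish λ t<c → vanish λ s<c →
    trans (sym (gapΣ-+ _ _ w)) (gapΣ-zero w λ { u v ≡.refl →
      anti t<c s<c (inj₁ λ ()) [] (sy ∷ proj₁ (++⁻ u sw)) (proj₂ (++⁻ u sw)) }))
    where
    vanish : ∀ {h : ℕ → Carrier} → (∀ {t} → t < c → h t ≈ 0#) → ∑ (upTo c) h ≈ 0#
    vanish p = trans (∑-congᴬ (All.map p (all-upTo c))) (∑-zero (upTo c))

  -- Split by how many large letters stand in front of the head y. Two give `adjacent`, one gives
  -- `separated`, and none leads to the induction hypothesis for `f ∘ (y ∷_)`.
  insert-pair : ∀ {w} → Small n w → (f : Word → Carrier) → Antisymmetric f →
    ∑ (upTo c) (λ t → insertΣ (A t) w (λ w′ → ∑ (upTo c) (λ s → insertΣ (B s) w′ f)))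
    ≈ ∑ (upTo c) (λ t → gapΣ (λ u v → f (u ++ A t ∷ B t ∷ v) + f (u ++ B t ∷ A t ∷ v)) w)
  insert-pair [] f anti = trans (∑-cong (upTo c) λ t → ∑-cong (upTo c) λ s → +-comm _ _) (adjacent [] f anti)
  insert-pair {y ∷ w} sw@(sy ∷ sw′) f anti = begin
    ∑ (upTo c) (λ t → ∑ (upTo c) (λ s → insertΣ (B s) (A t ∷ y ∷ w) f)
             + insertΣ (A t) w (λ w′ → ∑ (upTo c) (λ s → insertΣ (B s) (y ∷ w′) f)))
      ≈⟨ ∑-cong (upTo c) (λ t → +-cong
           (trans (∑-cong (upTo c) (λ s → swap-first _ _ _)) (∑-+ (upTo c) _ _))
           (trans (gapΣ-cong w (λ u v _ → ∑-+ (upTo c) _ _))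
             (trans (gapΣ-+ _ _ w) (+-congʳ (gapΣ-∑ (upTo c) _ w))))) ⟩
    ∑ (upTo c) (λ t → (∑ (upTo c) (λ s → f (A t ∷ B s ∷ y ∷ w) + f (B s ∷ A t ∷ y ∷ w)) + ∑ (upTo c) (b t)) + (∑ (upTo c) (d t) + T t))
      ≈⟨ ∑-cong (upTo c) (λ t → trans (regroup _ _ _ _)
           (+-congʳ (sym (∑-+ (upTo c) _ _)))) ⟩
    ∑ (upTo c) (λ t → ∑ (upTo c) (λ s → b t s + d t s) + (∑ (upTo c) (λ s → f (A t ∷ B s ∷ y ∷ w) + f (B s ∷ A t ∷ y ∷ w)) + T t))
      ≈⟨ trans (∑-+ (upTo c) _ _) (+-cong (separated sw f anti) (∑-+ (upTo c) _ _)) ⟩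
    0# + (∑ (upTo c) (λ t → ∑ (upTo c) (λ s → f (A t ∷ B s ∷ y ∷ w) + f (B s ∷ A t ∷ y ∷ w))) + ∑ (upTo c) T)
      ≈⟨ trans (+-identityˡ _) (+-cong (adjacent sw f anti) (insert-pair sw′ (f ∘ (y ∷_)) (λ p q r su → anti p q r (sy ∷ su)))) ⟩
    _ ≈⟨ ∑-+ (upTo c) _ _ ⟨
    ∑ (upTo c) (λ t → gapΣ (λ u v → f (u ++ A t ∷ B t ∷ v) + f (u ++ B t ∷ A t ∷ v)) (y ∷ w)) ∎
    where
    swap-first : ∀ x y z → x + (y + z) ≈ (y + x) + z
    swap-first = solve 3 (λ x y z → x :+ (y :+ z) := (y :+ x) :+ z) refl
    regroup : ∀ x y z t → (x + y) + (z + t) ≈ (y + z) + (x + t)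
    regroup = solve 4 (λ x y z t → (x :+ y) :+ (z :+ t) := (y :+ z) :+ (x :+ t)) refl
    b d : ℕ → ℕ → Carrier
    b t s = insertΣ (B s) w (λ w′ → f (A t ∷ y ∷ w′))
    d t s = insertΣ (A t) w (λ w′ → f (B s ∷ y ∷ w′))
    T : ℕ → Carrier
    T t = insertΣ (A t) w (λ w′ → ∑ (upTo c) (λ s → insertΣ (B s) w′ (f ∘ (y ∷_))))

-- Telescoping sum of a one-colored block over all gaps.

module BlockInsertion {a ℓ} (R : CommutativeRing a ℓ) (c n t : ℕ) (Q : CommutativeRing.Carrier R) where
  open CommutativeRing R
  open RingExpr R
  open Algebra.Properties.Ring ring
  open Sums R
  open Powers R
  open Block Q
  open Order c
  open import Relation.Binary.Reasoning.Setoid setoid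
  open Algebra.Solver.Ring.NaturalCoefficients.Default commutativeSemiring

  X Y : ℕ × ℕ
  X = suc n , t
  Y = 2 ℕ.+ n , t

  -- The minus sign is that of the additional inversion in the decreasing block; p is the position
  -- of the first letter of the whole word.
  J : ℕ → Word → Word → Carrier
  J p u v = pow Q (majFrom c p (u ++ X ∷ Y ∷ v)) + - pow Q (majFrom c p (u ++ Y ∷ X ∷ v))

  at : Bool → ℕ → ℕ
  at g p = if g then p else 0

  -- Twice the number of descents of `X ∷ a ∷ w`, the exponent carried from gap to gap in the
  -- telescoping.
  E : ℕ × ℕ → Word → ℕ
  E a w = at (gtC c X a) 2 ℕ.+ (des (a ∷ w) ℕ.+ des (a ∷ w))

  X<Y : gtC c X Y ≡ false
  X<Y = ≡.trans (gtC-same-color (suc n) (2 ℕ.+ n) t) (<ᵇ-false (n≤1+n (suc n)))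

  Y>X : gtC c Y X ≡ true
  Y>X = ≡.trans (gtC-same-color (2 ℕ.+ n) (suc n) t) (<ᵇ-true {suc n} ≤-refl)

  Y>small : ∀ {b} → proj₁ b ≤ n → gtC c Y b ≡ gtC c X b
  Y>small {_ , s} b≤n = ≡.trans (large>small t s (s≤s (ℕₚ.m≤n⇒m≤1+n b≤n))) (≡.sym (large>small t s (s≤s b≤n)))

  small>X : ∀ {b} → proj₁ b ≤ n → gtC c b X ≡ not (gtC c X b)
  small>X {_ , s} b≤n = small>large-flip t s (s≤s b≤n)

  small>Y : ∀ {b} → proj₁ b ≤ n → gtC c b Y ≡ not (gtC c X b)
  small>Y {_ , s} b≤n = ≡.trans (small>large-flip t s (s≤s (ℕₚ.m≤n⇒m≤1+n b≤n))) (≡.cong not (Y>small {_ , s} b≤n))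

  -- The two orders differ only in the descent inside the block, at position p. The letter after the
  -- block compares alike with `X` and `Y`.
  J-front : ∀ p b w → proj₁ b ≤ n →
    J p [] (b ∷ w) ≈ pow Q (at (gtC c X b) (suc p) ℕ.+ majFrom c (2 ℕ.+ p) (b ∷ w)) * (1# + - pow Q p)
  J-front p b w b≤n rewrite X<Y | Y>X | Y>small {b} b≤n = pow-diff Q p _

  J-end : ∀ p a → proj₁ a ≤ n → J p (a ∷ []) [] ≈ pow Q (at (not (gtC c X a)) p) * U p
  J-end p a a≤n rewrite X<Y | Y>X | small>X {a} a≤n | small>Y {a} a≤n
    | ℕₚ.+-identityʳ p | ℕₚ.+-identityʳ (at (not (gtC c X a)) p) | ℕₚ.+-comm (at (not (gtC c X a)) p) (suc p) =
    pow-diff Q (suc p) _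

  J-cons : ∀ p a b u v → J p (a ∷ b ∷ u) v ≈ pow Q (at (gtC c a b) p) * J (suc p) (b ∷ u) v
  J-cons p a b u v = pow-+-diff Q (at (gtC c a b) p) _ _

  J-after : ∀ p a b w → proj₁ a ≤ n →
    J p (a ∷ []) (b ∷ w) ≈ pow Q (at (not (gtC c X a)) p) * J (suc p) [] (b ∷ w)
  J-after p a b w a≤n rewrite small>X {a} a≤n | small>Y {a} a≤n = pow-+-diff Q (at (not (gtC c X a)) p) _ _

  pow-shift : ∀ p w → pow Q (majFrom c (2 ℕ.+ p) w) ≈ pow Q (des w ℕ.+ des w) * pow Q (majFrom c p w)
  pow-shift p w = trans (reflexive (≡.cong (pow Q) (≡.trans (majFrom-shift (suc p) w)
    (≡.trans (≡.cong (des w ℕ.+_) (majFrom-shift p w)) (≡.sym (ℕₚ.+-assoc (des w) (des w) _)))))) (pow-+ Q (des w ℕ.+ des w) _)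

  -- One telescoping step without the common powers of Q: the gap between a and b, plus the
  -- correction term at a, is the correction term at b. Each admissible pattern of comparisons
  -- reduces to the definition of `B` or to `B-suc`.
  gap-exchange : ∀ p {xa xb ab} → Compatible xa xb ab →
    pow Q (at (not xa) p) * (pow Q (at xb (2 ℕ.+ p)) * U p)
      + pow Q (at ab p) * (pow Q (at xa 2 ℕ.+ (at ab 1 ℕ.+ at ab 1)) * B p)
    ≈ pow Q (at ab p) * (pow Q (at xb 2) * B (suc p))
  gap-exchange p (both {true}) = trans
    (solve 4 (λ Q P U B → con 1 :* ((Q :* (Q :* P)) :* U) :+ P :* ((Q :* (Q :* (Q :* (Q :* con 1)))) :* B)
                        := P :* ((Q :* (Q :* con 1)) :* (U :+ Q :* Q :* B))) refl Q (pow Q p) (U p) (B p))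
    (*-congˡ (*-congˡ (sym (B-suc p))))
  gap-exchange p (both {false}) =
    solve 4 (λ Q P U B → con 1 :* ((Q :* (Q :* P)) :* U) :+ con 1 :* ((Q :* (Q :* con 1)) :* B)
                       := con 1 :* ((Q :* (Q :* con 1)) :* (B :+ P :* U))) refl Q (pow Q p) (U p) (B p)
  gap-exchange p (none {true}) = trans
    (solve 4 (λ Q P U B → P :* (con 1 :* U) :+ P :* ((Q :* (Q :* con 1)) :* B)
                        := P :* (con 1 :* (U :+ Q :* Q :* B))) refl Q (pow Q p) (U p) (B p))
    (*-congˡ (*-congˡ (sym (B-suc p))))
  gap-exchange p (none {false}) =
    solve 4 (λ Q P U B → P :* (con 1 :* U) :+ con 1 :* (con 1 :* B)
                       := con 1 :* (con 1 :* (B :+ P :* U))) refl Q (pow Q p) (U p) (B p)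
  gap-exchange p b<x<a =
    solve 4 (λ Q P U B → P :* ((Q :* (Q :* P)) :* U) :+ P :* ((Q :* (Q :* con 1)) :* B)
                       := P :* ((Q :* (Q :* con 1)) :* (B :+ P :* U))) refl Q (pow Q p) (U p) (B p)
  gap-exchange p a<x<b = trans
    (solve 4 (λ Q P U B → con 1 :* (con 1 :* U) :+ con 1 :* ((Q :* (Q :* con 1)) :* B)
                        := con 1 :* (con 1 :* (U :+ Q :* Q :* B))) refl Q (pow Q p) (U p) (B p))
    (*-congˡ (*-congˡ (sym (B-suc p))))

  J-front-pow : ∀ p b w → proj₁ b ≤ n →
    J (suc p) [] (b ∷ w) ≈ pow Q (at (gtC c X b) (2 ℕ.+ p)) * U p * (pow Q (des (b ∷ w) ℕ.+ des (b ∷ w)) * pow Q (majFrom c (suc p) (b ∷ w)))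
  J-front-pow p b w b≤n = begin
    J (suc p) [] (b ∷ w)                               ≈⟨ J-front (suc p) b w b≤n ⟩
    pow Q (i ℕ.+ majFrom c (3 ℕ.+ p) (b ∷ w)) * U p    ≈⟨ *-congʳ (trans (pow-+ Q i _) (*-congˡ (pow-shift (suc p) (b ∷ w)))) ⟩
    pow Q i * (D * F) * U p                            ≈⟨ solve 4 (λ i D F U → i :* (D :* F) :* U := i :* U :* (D :* F)) refl (pow Q i) D F (U p) ⟩
    pow Q i * U p * (D * F)                            ∎
    where
    i = at (gtC c X b) (2 ℕ.+ p)
    D = pow Q (des (b ∷ w) ℕ.+ des (b ∷ w))
    F = pow Q (majFrom c (suc p) (b ∷ w))

  -- The gaps after a contribute Q^maj (B (N + 1) - Q^E B p); both sides are moved so that no subtraction occurs.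
  gaps-after : ∀ p {a w} → Small n (a ∷ w) →
    gapΣ (λ u v → J p (a ∷ u) v) w + pow Q (majFrom c p (a ∷ w)) * (pow Q (E a w) * B p)
    ≈ pow Q (majFrom c p (a ∷ w)) * B (suc (p ℕ.+ length w))
  gaps-after p {a} {[]} (a≤n ∷ []) rewrite ℕₚ.+-identityʳ p = begin
    J p (a ∷ []) [] + 1# * (pow Q (E a []) * B p)   ≈⟨ +-congʳ (J-end p a a≤n) ⟩
    pow Q (at (not (gtC c X a)) p) * U p + 1# * (pow Q (E a []) * B p) ≈⟨ last (gtC c X a) ⟩
    1# * B (suc p) ∎
    where
    last : ∀ g → pow Q (at (not g) p) * U p + 1# * (pow Q (at g 2 ℕ.+ 0) * B p) ≈ 1# * B (suc p)
    last true  = trans (solve 3 (λ Q U B → con 1 :* U :+ con 1 :* ((Q :* (Q :* con 1)) :* B) := con 1 :* (U :+ Q :* Q :* B)) refl Q (U p) (B p))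
                   (*-congˡ (sym (B-suc p)))
    last false = solve 3 (λ P U B → P :* U :+ con 1 :* (con 1 :* B) := con 1 :* (B :+ P :* U)) refl (pow Q p) (U p) (B p)
  gaps-after p {a} {b ∷ w} (a≤n ∷ sb@(b≤n ∷ sw)) = begin
    (J p (a ∷ []) (b ∷ w) + gapΣ (λ u v → J p (a ∷ b ∷ u) v) w) + pow Q (g ℕ.+ m) * (pow Q (E a (b ∷ w)) * B p)
      ≈⟨ +-cong (+-cong (trans (J-after p a b w a≤n) (*-congˡ (J-front-pow p b w b≤n)))
                        (trans (gapΣ-cong w (λ u v _ → J-cons p a b u v)) (gapΣ-*ˡ (pow Q g) _ w)))
                (*-cong (pow-+ Q g m) (*-congʳ (trans (reflexive (≡.cong (pow Q) E-cons)) (pow-+ Q e (d ℕ.+ d))))) ⟩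
    (α * (β * U p * (D * F)) + γ * S) + γ * F * (ε * D * B p)
      ≈⟨ solve 9 (λ α β U D F γ S ε B → (α :* (β :* U :* (D :* F)) :+ γ :* S) :+ γ :* F :* (ε :* D :* B)
                                      := (α :* (β :* U) :+ γ :* (ε :* B)) :* (D :* F) :+ γ :* S)
           refl α β (U p) D F γ S ε (B p) ⟩
    (α * (β * U p) + γ * (ε * B p)) * (D * F) + γ * S
      -- The first gap and the correction at a are traded for the correction at b, which is what the
      -- induction hypothesis at position p + 1 requires.
      ≈⟨ +-congʳ (*-congʳ (gap-exchange p (compatible t (proj₂ a) (proj₂ b) (s≤s a≤n) (s≤s b≤n)))) ⟩
    γ * (δ * B (suc p)) * (D * F) + γ * S
      ≈⟨ solve 6 (λ γ δ B D F S → γ :* (δ :* B) :* (D :* F) :+ γ :* S := γ :* (S :+ F :* (δ :* D :* B)))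
           refl γ δ (B (suc p)) D F S ⟩
    γ * (S + F * (δ * D * B (suc p)))
      ≈⟨ *-congˡ (+-congˡ (*-congˡ (*-congʳ (pow-+ Q (at (gtC c X b) 2) (d ℕ.+ d))))) ⟨
    γ * (S + F * (pow Q (E b w) * B (suc p)))
      ≈⟨ *-congˡ (gaps-after (suc p) sb) ⟩
    γ * (F * B (suc (suc p ℕ.+ length w)))
      ≈⟨ *-assoc _ _ _ ⟨
    γ * F * B (suc (suc p ℕ.+ length w))
      ≈⟨ *-cong (sym (pow-+ Q g m)) (reflexive (≡.cong (B ∘ suc) (≡.sym (ℕₚ.+-suc p (length w))))) ⟩
    pow Q (g ℕ.+ m) * B (suc (p ℕ.+ length (b ∷ w))) ∎
    where
    g = at (gtC c a b) p
    m = majFrom c (suc p) (b ∷ w)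
    d = des (b ∷ w)
    i = at (gtC c a b) 1
    e = at (gtC c X a) 2 ℕ.+ (i ℕ.+ i)
    α = pow Q (at (not (gtC c X a)) p)
    β = pow Q (at (gtC c X b) (2 ℕ.+ p))
    γ = pow Q g
    δ = pow Q (at (gtC c X b) 2)
    ε = pow Q e
    D = pow Q (d ℕ.+ d)
    F = pow Q m
    S = gapΣ (λ u v → J (suc p) (b ∷ u) v) w
    E-cons : E a (b ∷ w) ≡ e ℕ.+ (d ℕ.+ d)
    E-cons = +-*-Solver.solve 3 (λ x i d → x +-*-Solver.:+ ((i +-*-Solver.:+ d) +-*-Solver.:+ (i +-*-Solver.:+ d))
      +-*-Solver.:= (x +-*-Solver.:+ (i +-*-Solver.:+ i)) +-*-Solver.:+ (d +-*-Solver.:+ d)) ≡.refl (at (gtC c X a) 2) i d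

  -- The gap in front of the word contributes exactly the correction term of `gaps-after` at p = 1,
  -- because B 1 = U 0.
  all-gaps : ∀ {w} → Small n w → gapΣ (J 1) w ≈ pow Q (maj c w) * B (suc (length w))
  all-gaps [] rewrite X<Y | Y>X = solve 1 (λ u → con 1 :+ u := con 1 :* (con 0 :+ con 1 :* (con 1 :+ u))) refl _
  all-gaps {b ∷ w} sb@(b≤n ∷ _) = begin
    J 1 [] (b ∷ w) + gapΣ (λ u v → J 1 (b ∷ u) v) w    ≈⟨ +-congʳ (J-front-pow 0 b w b≤n) ⟩
    pow Q (at (gtC c X b) 2) * U 0 * (D * F) + S
      ≈⟨ solve 5 (λ x U D F S → x :* U :* (D :* F) :+ S := S :+ F :* (x :* D :* (con 0 :+ con 1 :* U))) refl _ (U 0) D F S ⟩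
    S + F * (pow Q (at (gtC c X b) 2) * D * B 1)       ≈⟨ +-congˡ (*-congˡ (*-congʳ (pow-+ Q (at (gtC c X b) 2) _))) ⟨
    S + F * (pow Q (E b w) * B 1)                      ≈⟨ gaps-after 1 sb ⟩
    F * B (2 ℕ.+ length w)                             ∎
    where
    D = pow Q (des (b ∷ w) ℕ.+ des (b ∷ w))
    F = pow Q (majFrom c 1 (b ∷ w))
    S = gapΣ (λ u v → J 1 (b ∷ u) v) w

-- Signed weights and the recursion by two letters.

data Parity : ℕ → Set where
  even : ∀ j → Parity (j ℕ.+ j)
  odd  : ∀ j → Parity (suc (j ℕ.+ j))

parity : ∀ m → Parity m
parity zero    = even 0
parity (suc m) with parity m
... | even j = odd j
... | odd j  = ≡.subst Parity (≡.cong suc (ℕₚ.+-suc j j)) (even (suc j))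

module SignedFlagMajor {a ℓ} (R : CommutativeRing a ℓ) (c : ℕ) (2∣c : 2 ∣ c) (q : CommutativeRing.Carrier R) where
  open CommutativeRing R
  open RingExpr R
  open Algebra.Properties.Ring ring
  open Sums R
  open Enumeration c
  open Powers R
  open import Relation.Binary.Reasoning.Setoid setoid
  open Algebra.Solver.Ring.NaturalCoefficients.Default commutativeSemiring

  Q : Carrier
  Q = pow q c

  open Block Q

  -- The sign of the color number is absorbed into the base -q, leaving only the inversions as an
  -- explicit sign.
  weight : Word → Carrier
  weight w = pow (- 1#) (inv w) * (pow (- q) (col w) * pow Q (maj c w))

  -- The middle summand of `L` is a multiple of the even number c, so it does not affect the sign.
  term≈weight : ∀ w → pow (- 1#) (L c w) * pow q (fmaj c w) ≈ weight w
  term≈weight w = begin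
    pow (- 1#) (col w ℕ.+ k ℕ.+ inv w) * pow q (c ℕ.* maj c w ℕ.+ col w)
      ≈⟨ *-cong (trans (pow-+ (- 1#) (col w ℕ.+ k) (inv w)) (*-congʳ (trans (pow-+ (- 1#) (col w) k) (*-congˡ (neg-one-even (∣m⇒∣m*n _ 2∣c))))))
                (trans (pow-+ q (c ℕ.* maj c w) (col w)) (*-congʳ (pow-* q c (maj c w)))) ⟩
    (pow (- 1#) (col w) * 1# * pow (- 1#) (inv w)) * (pow Q (maj c w) * pow q (col w))
      ≈⟨ solve 4 (λ s i M y → (s :* con 1 :* i) :* (M :* y) := i :* ((s :* y) :* M)) refl
           (pow (- 1#) (col w)) (pow (- 1#) (inv w)) (pow Q (maj c w)) (pow q (col w)) ⟩
    pow (- 1#) (inv w) * ((pow (- 1#) (col w) * pow q (col w)) * pow Q (maj c w))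
      ≈⟨ *-congˡ (*-congʳ (pow-neg q (col w))) ⟨
    weight w ∎
    where k = c ℕ.* nzAsc [] w

  module _ (n : ℕ) where
    open Pairing R c n using (A; Antisymmetric; insert-pair) renaming (B to A′)

    weight-antisymmetric : Antisymmetric weight
    weight-antisymmetric {t} {s} {u} {v} {z} t<c s<c apart su sv sz
      rewrite inv-swap t s su sv sz | col-swap (2 ℕ.+ n) (suc n) t s u v z
            | Order.majFrom-same c 1 (Order.same-swap c {x = 2 ℕ.+ n} {suc n} (ℕₚ.m<n⇒m<1+n ≤-refl) ≤-refl t<c s<c apart su sv sz) = begin
      i * k + (- 1# * i) * k   ≈⟨ solve 3 (λ i k m → i :* k :+ (m :* i) :* k := (con 1 :+ m) :* (i :* k)) refl i k (- 1#) ⟩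
      (1# + - 1#) * (i * k)    ≈⟨ *-congʳ (-‿inverseʳ 1#) ⟩
      0# * (i * k)             ≈⟨ zeroˡ _ ⟩
      0#                       ∎
      where
      w = u ++ A t ∷ v ++ A′ s ∷ z
      i = pow (- 1#) (inv w)
      k = pow (- q) (col w) * pow Q (maj c w)

    -- The block adds even amounts to both the color number and the inversions of the rest, so its
    -- color yields (q²)^t without sign. The one inversion inside the decreasing block turns the sum
    -- into the difference `J`.
    weight-block : ∀ t u v → Small n u → Small n v →
      weight (u ++ A t ∷ A′ t ∷ v) + weight (u ++ A′ t ∷ A t ∷ v)
      ≈ pow (- 1#) (inv (u ++ v)) * pow (- q) (col (u ++ v)) * pow (q * q) t * BlockInsertion.J R c n t Q 1 u v
    weight-block t u v su sv
      rewrite inv-swap t t su [] sv | inv-block t su sv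
            | col-block (2 ℕ.+ n) (suc n) t u v | col-block (suc n) (2 ℕ.+ n) t u v = begin
      pow (- 1#) (2v ℕ.+ inv w) * (pow (- q) (2t ℕ.+ col w) * M) + (- 1# * pow (- 1#) (2v ℕ.+ inv w)) * (pow (- q) (2t ℕ.+ col w) * M′)
        ≈⟨ +-cong (*-cong sign (*-congʳ color)) (*-cong (*-congˡ sign) (*-congʳ color)) ⟩
      i * (p * k * M) + (- 1# * i) * (p * k * M′)
        ≈⟨ solve 6 (λ i p k M m M′ → i :* (p :* k :* M) :+ (m :* i) :* (p :* k :* M′) := i :* k :* p :* (M :+ m :* M′)) refl i p k M (- 1#) M′ ⟩
      i * k * p * (M + - 1# * M′)
        ≈⟨ *-congˡ (+-congˡ (-1*x≈-x M′)) ⟩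
      i * k * p * (M + - M′) ∎
      where
      w = u ++ v
      2v = length v ℕ.+ length v
      2t = t ℕ.+ t
      i = pow (- 1#) (inv w)
      k = pow (- q) (col w)
      p = pow (q * q) t
      M  = pow Q (maj c (u ++ A t ∷ A′ t ∷ v))
      M′ = pow Q (maj c (u ++ A′ t ∷ A t ∷ v))
      sign : pow (- 1#) (2v ℕ.+ inv w) ≈ i
      sign = trans (pow-+ (- 1#) 2v (inv w)) (trans (*-congʳ (neg-one-double (length v))) (*-identityˡ _))
      color : pow (- q) (2t ℕ.+ col w) ≈ p * k
      color = trans (pow-+ (- q) 2t (col w)) (*-congʳ (trans (pow-neg-double q t) (pow-double q t)))

    weight-insert-pair : ∀ {w} → Small n w → length w ≡ n →
      ∑ (upTo c) (λ t → insertΣ (A t) w (λ w′ → ∑ (upTo c) (λ s → insertΣ (A′ s) w′ weight)))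
      ≈ weight w * (qint c (q * q) * B (suc n))
    weight-insert-pair {w} sw |w|≡n = begin
      ∑ (upTo c) (λ t → insertΣ (A t) w (λ w′ → ∑ (upTo c) (λ s → insertΣ (A′ s) w′ weight)))
        ≈⟨ insert-pair sw weight weight-antisymmetric ⟩
      ∑ (upTo c) (λ t → gapΣ (λ u v → weight (u ++ A t ∷ A′ t ∷ v) + weight (u ++ A′ t ∷ A t ∷ v)) w)
        -- The sum over gaps depends on t only through (q²)^t, so the sum over colors factors off.
        ≈⟨ ∑-cong (upTo c) block ⟩
      ∑ (upTo c) (λ t → pow (q * q) t * (weight w * B (suc n)))
        ≈⟨ ∑-*ʳ (upTo c) _ _ ⟩
      ∑ (upTo c) (pow (q * q)) * (weight w * B (suc n))
        ≈⟨ *-congʳ (∑-pow c (q * q)) ⟩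
      qint c (q * q) * (weight w * B (suc n))
        ≈⟨ solve 3 (λ x y z → x :* (y :* z) := y :* (x :* z)) refl _ _ _ ⟩
      weight w * (qint c (q * q) * B (suc n)) ∎
      where
      block : ∀ t → gapΣ (λ u v → weight (u ++ A t ∷ A′ t ∷ v) + weight (u ++ A′ t ∷ A t ∷ v)) w
                    ≈ pow (q * q) t * (weight w * B (suc n))
      block t = begin
        gapΣ (λ u v → weight (u ++ A t ∷ A′ t ∷ v) + weight (u ++ A′ t ∷ A t ∷ v)) w
          ≈⟨ gapΣ-cong w (λ { u v ≡.refl → weight-block t u v (proj₁ (++⁻ u sw)) (proj₂ (++⁻ u sw)) }) ⟩
        gapΣ (λ u v → i * k * p * BlockInsertion.J R c n t Q 1 u v) w
          ≈⟨ gapΣ-*ˡ (i * k * p) _ w ⟩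
        i * k * p * gapΣ (BlockInsertion.J R c n t Q 1) w
          ≈⟨ *-congˡ (BlockInsertion.all-gaps R c n t Q sw) ⟩
        i * k * p * (pow Q (maj c w) * B (suc (length w)))
          ≡⟨ ≡.cong (λ m → i * k * p * (pow Q (maj c w) * B (suc m))) |w|≡n ⟩
        i * k * p * (pow Q (maj c w) * B (suc n))
          ≈⟨ solve 5 (λ i k p M b → i :* k :* p :* (M :* b) := p :* ((i :* (k :* M)) :* b)) refl i k p _ _ ⟩
        p * (weight w * B (suc n)) ∎
        where
        i = pow (- 1#) (inv w)
        k = pow (- q) (col w)
        p = pow (q * q) t

    ∑-weight-step : ∑ (G c (2 ℕ.+ n)) weight ≈ ∑ (G c n) weight * (qint c (q * q) * B (suc n))
    ∑-weight-step = begin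
      ∑ (G c (2 ℕ.+ n)) weight                            ≈⟨ trans (∑-G-suc (suc n) weight) (∑-G-suc n _) ⟩
      _                                                   ≈⟨ ∑-G-cong n (λ w sw |w|≡n → weight-insert-pair sw |w|≡n) ⟩
      ∑ (G c n) (λ w → weight w * (qint c (q * q) * B (suc n))) ≈⟨ ∑-*ʳ (G c n) weight _ ⟩
      ∑ (G c n) weight * (qint c (q * q) * B (suc n))     ∎

  -- Matching with consecutive factors of the product.

  qint-positive : ∀ j → qint (c ℕ.* (j ℕ.+ j)) q ≈ (1# + q) * (qint c (q * q) * qint j (Q * Q))
  qint-positive j = begin
    qint (c ℕ.* (j ℕ.+ j)) q              ≡⟨ ≡.cong (λ m → qint m q) (≡.trans (ℕₚ.*-distribˡ-+ c j j) (≡.cong (c ℕ.* j ℕ.+_) (≡.sym (ℕₚ.+-identityʳ _)))) ⟩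
    -- The exponents are grouped by parity first and then modulo c, with (q²)^c = Q².
    qint (2 ℕ.* (c ℕ.* j)) q              ≈⟨ qint-* 2 (c ℕ.* j) q ⟩
    qint 2 q * qint (c ℕ.* j) (pow q 2)   ≈⟨ *-cong (solve 1 (λ q → con 1 :+ q :* (con 1 :+ q :* con 0) := con 1 :+ q) refl q)
                                                (qint-cong (c ℕ.* j) (*-congˡ (*-identityʳ q))) ⟩
    (1# + q) * qint (c ℕ.* j) (q * q)     ≈⟨ *-congˡ (trans (qint-* c j (q * q)) (*-congˡ (qint-cong j (pow-product q q c)))) ⟩
    (1# + q) * (qint c (q * q) * qint j (Q * Q)) ∎

  -- The exponent c(m+1) is even, so the power of -q loses its sign. The factor 1 + q is supplied by
  -- the neighbouring factor of even index.
  qint-negative : ∀ m → (1# + q) * qint (c ℕ.* suc m) (- q) ≈ U m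
  qint-negative m = begin
    (1# + q) * qint (c ℕ.* suc m) (- q)        ≈⟨ *-congʳ (+-congˡ (-‿involutive q)) ⟨
    (1# + - - q) * qint (c ℕ.* suc m) (- q)    ≈⟨ qint-geometric (- q) (c ℕ.* suc m) ⟩
    1# + - pow (- q) (c ℕ.* suc m)             ≈⟨ +-congˡ (-‿cong (trans (pow-neg-even q (∣m⇒∣m*n _ 2∣c)) (pow-* q c (suc m)))) ⟩
    U m                                        ∎

  factor : ℕ → Carrier
  factor m = qint (c ℕ.* m) (pow (- 1#) m * q)

  factor-even : ∀ j → factor (j ℕ.+ j) ≈ qint (c ℕ.* (j ℕ.+ j)) q
  factor-even j = qint-cong (c ℕ.* (j ℕ.+ j)) (trans (*-congʳ (neg-one-double j)) (*-identityˡ q))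

  factor-odd : ∀ j → factor (suc (j ℕ.+ j)) ≈ qint (c ℕ.* suc (j ℕ.+ j)) (- q)
  factor-odd j = qint-cong (c ℕ.* suc (j ℕ.+ j)) (begin
    - 1# * pow (- 1#) (j ℕ.+ j) * q  ≈⟨ *-congʳ (trans (*-congˡ (neg-one-double j)) (*-identityʳ _)) ⟩
    - 1# * q                         ≈⟨ -1*x≈-x q ⟩
    - q                              ∎)

  -- One of two consecutive indices is even. Its 1 + q completes the odd factor to a value of `U`,
  -- and its q-integer in Q² is the one in the closed form of `B`.
  factor-pair : ∀ m → factor m * factor (suc m) ≈ qint c (q * q) * B m
  factor-pair m with parity m
  ... | even j = begin
    factor (j ℕ.+ j) * factor (suc (j ℕ.+ j))
      ≈⟨ *-cong (trans (factor-even j) (qint-positive j)) (factor-odd j) ⟩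
    (1# + q) * (qint c (q * q) * qint j (Q * Q)) * qint (c ℕ.* suc (j ℕ.+ j)) (- q)
      ≈⟨ solve 4 (λ x y z t → x :* (y :* z) :* t := y :* ((x :* t) :* z)) refl (1# + q) _ _ _ ⟩
    qint c (q * q) * ((1# + q) * qint (c ℕ.* suc (j ℕ.+ j)) (- q) * qint j (Q * Q))
      ≈⟨ *-congˡ (trans (*-congʳ (qint-negative (j ℕ.+ j))) (sym (B-even j))) ⟩
    qint c (q * q) * B (j ℕ.+ j) ∎
  ... | odd j = begin
    factor (suc (j ℕ.+ j)) * factor (2 ℕ.+ (j ℕ.+ j))
      ≡⟨ ≡.cong (λ m → factor (suc (j ℕ.+ j)) * factor (suc m)) (ℕₚ.+-suc j j) ⟨
    factor (suc (j ℕ.+ j)) * factor (suc j ℕ.+ suc j)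
      ≈⟨ *-cong (factor-odd j) (trans (factor-even (suc j)) (qint-positive (suc j))) ⟩
    qint (c ℕ.* suc (j ℕ.+ j)) (- q) * ((1# + q) * (qint c (q * q) * qint (suc j) (Q * Q)))
      ≈⟨ solve 4 (λ t x y z → t :* (x :* (y :* z)) := y :* ((x :* t) :* z)) refl _ (1# + q) _ (qint (suc j) (Q * Q)) ⟩
    qint c (q * q) * ((1# + q) * qint (c ℕ.* suc (j ℕ.+ j)) (- q) * qint (suc j) (Q * Q))
      ≈⟨ *-congˡ (trans (*-congʳ (qint-negative (j ℕ.+ j))) (sym (B-odd j))) ⟩
    qint c (q * q) * B (suc (j ℕ.+ j)) ∎

  -- `prodFrom` unfolds at the smallest index, while the induction appends factors at the largest.
  prodFrom-snoc : ∀ i k → prodFrom c i (suc k) q ≈ prodFrom c i k q * factor (i ℕ.+ k)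
  prodFrom-snoc i zero rewrite ℕₚ.+-identityʳ i = *-comm _ _
  prodFrom-snoc i (suc k) rewrite ℕₚ.+-suc i k = trans (*-congˡ (prodFrom-snoc (suc i) k)) (sym (*-assoc _ _ _))

  ∑-weight : ∀ n → ∑ (G c n) weight ≈ rhs c n q
  ∑-weight zero          = solve 0 (con 1 :* (con 1 :* con 1) :+ con 0 := con 1) refl
  ∑-weight (suc zero)    = begin
    ∑ (G c 1) weight                   ≈⟨ trans (∑-G-suc 0 weight) (+-identityʳ _) ⟩
    ∑ (upTo c) (λ t → weight ((1 , t) ∷ []))
      ≈⟨ ∑-cong (upTo c) (λ t → trans (*-identityˡ _) (trans (*-identityʳ _) (reflexive (≡.cong (pow (- q)) (ℕₚ.+-identityʳ t))))) ⟩
    ∑ (upTo c) (pow (- q))             ≈⟨ ∑-pow c (- q) ⟩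
    qint c (- q)                       ≡⟨ ≡.cong (λ m → qint m (- q)) (ℕₚ.*-identityʳ c) ⟨
    qint (c ℕ.* 1) (- q)               ≈⟨ factor-odd 0 ⟨
    factor 1                           ≈⟨ *-identityʳ _ ⟨
    rhs c 1 q                          ∎
  ∑-weight (suc (suc n)) = begin
    ∑ (G c (2 ℕ.+ n)) weight                           ≈⟨ ∑-weight-step n ⟩
    ∑ (G c n) weight * (qint c (q * q) * B (suc n))    ≈⟨ *-cong (∑-weight n) (sym (factor-pair (suc n))) ⟩
    rhs c n q * (factor (suc n) * factor (2 ℕ.+ n))    ≈⟨ *-assoc _ _ _ ⟨
    rhs c n q * factor (suc n) * factor (2 ℕ.+ n)      ≈⟨ *-congʳ (prodFrom-snoc 1 n) ⟨
    rhs c (suc n) q * factor (2 ℕ.+ n)                 ≈⟨ prodFrom-snoc 1 (suc n) ⟨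
    rhs c (2 ℕ.+ n) q                                  ∎

theorem2p1 : ∀ {a ℓ : Level} (R : CommutativeRing a ℓ) (c n : ℕ) →
    0 < c → 2 ∣ c → 1 ≤ n → (q : CommutativeRing.Carrier R) →
    CommutativeRing._≈_ R (RingExpr.lhs R c n q) (RingExpr.rhs R c n q)
theorem2p1 R c n _ 2∣c _ q = trans (∑-cong (G c n) term≈weight) (∑-weight n)
  where
  open CommutativeRing R using (trans)
  open Sums R using (∑-cong)
  open SignedFlagMajor R c 2∣c q
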